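{- Let $\lambda$ be a partition. For each reverse plane partition $\pi$ of shape $\lambda$ there exists a unique sequence of rim-hooks $h_1\leq\dots\leq h_s$ of $\lambda$ (with respect to the rim-hook order) such that $h_i$ inserts into $h_{i+1}*\cdots*h_s*0$ for all $i\in\{1,\dots,s\}$, and \[\pi=h_1*\cdots*h_s*0,\] where $0$ is the zero reverse plane partition of shape $\lambda$. The correspondence $\pi\mapsto(h_1,\dots,h_s)$ gives a bijection between reverse plane partitions of shape $\lambda$ and finite multi-sets of rim-hooks of $\lambda$.
   Context: Cells are pairs $(i,j)\in\mathbb Z^2$; for $u=(i,j)$ write $\mathrm n u=(i-1,j)$, $\mathrm e u=(i,j+1)$, $\mathrm s u=(i+1,j)$, $\mathrm w u=(i,j-1)$ (composites such as $\mathrm e\mathrm s u$ are applied successively). A partition $\lambda=(\lambda_1\ge\dots\ge\lambda_r>0)$ is identified with its Young diagram $\{(i,j):1\le i\le r,\ 1\le j\le\lambda_i\}$; $\lambda'$ is the conjugate partition. A reverse plane partition of shape $\lambda$ is a map $\pi:\lambda\to\mathbb N=\{0,1,2,\dots\}$ with $\pi(u)\le\pi(\mathrm e u)$ and $\pi(u)\le\pi(\mathrm s u)$ for all $u\in\lambda$, using the conventions $\pi(i,j)=0$ if $i\le0$ or $j\le0$, and $\pi(i,j)=\infty$ if $i,j\ge1$ and $(i,j)\notin\lambda$. The zero reverse plane partition has all entries $0$. Content: $c(i,j)=j-i$. A cell $u\in\lambda$ is an outer corner if $\mathrm e u,\mathrm s u\notin\lambda$, an inner corner if $\mathrm e u,\mathrm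 s u\in\lambda$ but $\mathrm e\mathrm s u\notin\lambda$. Let $i_1<\dots<i_r$ be the contents of the inner corners and $o_1<\dots<o_{r+1}$ those of the outer corners, so $o_1<i_1<o_2<\dots<o_r<i_r<o_{r+1}$. Put $\mathcal I=\{u\in\lambda:c(u)=i_k\text{ for some }k\}$, $\mathcal O=\{u\in\lambda:c(u)=o_k\text{ for some }k\}$, $\mathcal A=\{u\in\lambda:c(u)<o_1\text{ or }i_k<c(u)<o_{k+1}\text{ for some }k\in[r]\}$, $\mathcal B=\{u\in\lambda:o_k<c(u)<i_k\text{ for some }k\in[r]\text{ or }o_{r+1}<c(u)\}$. A north-east path is a sequence $P=(u_0,\dots,u_s)$ of cells of $\lambda$ with $u_k\in\{\mathrm n u_{k-1},\mathrm e u_{k-1}\}$; its length is $\ell(P)=s$, head $\alpha(P)=u_0$, tail $\omega(P)=u_s$. A south-west path is $Q=(v_0,\dots,v_s)$ with $v_k\in\{\mathrm s v_{k-1},\mathrm w v_{k-1}\}$; $\ell(Q)=s$, $\alpha(Q)=v_s$, $\omega(Q)=v_0$. A rim-hook of $\lambda$ is a north-east path $h$ in $\lambda$ with $\mathrm s\alpha(h)\notin\lambda$, $\mathrm e\omega(h)\notin\lambda$ and $\mathrm e\mathrm s u\notin\lambda$ for all $u\in h$; for each $u=(i,j)\in\lambda$ there is a unique rim-hook $h^u$ with $\alpha(h^u)=(\lambda'_j,j)$ and $\omega(h^u)=(i,\lambda_i)$, and every rim-hook arises this way. Reverse lexicographic order on cells: $(i,j)\le(k,l)$ iff $j>l$,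 or $j=l$ and $i\ge k$. Rim-hooks are ordered by $h^u\le h^v$ iff $u\le v$. For a path $P$ let $(\pi+P)(u)=\pi(u)+1$ if $u\in P$ and $\pi(u)$ otherwise. $(P,\pi)$ is compatible if (1) $u\in P$, $u\in\mathcal I\cup\mathcal A$ imply $\mathrm e u\in P$ and $\pi(u)=\pi(\mathrm e u)$; and (2) $u,\mathrm s u\in P$ imply $\pi(u)=\pi(\mathrm s u)$. A rim-hook $h$ inserts into $\pi$ if there is a path $P$ with $\omega(P)=\omega(h)$, $\ell(P)=\ell(h)$, $(P,\pi)$ compatible and $\pi+P$ a reverse plane partition. In that case $h*\pi=\pi+P(h,\pi)$, where $P(h,\pi)$ is the south-west path constructed by starting at $\omega(h)$ and, while its length is less than $\ell(h)$, moving from the current cell $u$ to $\mathrm s u$ if $u\in\mathcal B\cup\mathcal I$ and $\pi(u)=\pi(\mathrm s u)$, and to $\mathrm w u$ otherwise. Iterated insertions are read right to left: $h_1*h_2*\cdots*h_s*0=h_1*(h_2*(\cdots(h_s*0)))$. -}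

module Defs where

open import Data.Nat using (ℕ; zero; suc; _+_; _∸_; _≤_; _<_; _≥_; _>_; _≤?_)
import Data.Nat.Properties as ℕP
open import Data.Integer using (ℤ; _⊖_) renaming (_<_ to _<ℤ_; _<?_ to _<ℤ?_)
import Data.Integer.Properties as ℤP
open import Data.Bool using (Bool; true; false; if_then_else_)
open import Data.List using (List; []; _∷_; length; filter; concatMap; map; upTo; foldr; any)
open import Data.List.NonEmpty using (List⁺; _∷_; head; last; toList)
  renaming (length to length⁺)
open import Data.List.Membership.Propositional using (_∈_)
open import Data.List.Relation.Unary.Linked using (Linked)
open import Data.List.Relation.Unary.All using (All)
open import Data.Product using (_×_; _,_; proj₁; proj₂; ∃; ∃-syntax; Σ-syntax)
open import Data.Product.Properties using (≡-dec)
open import Data.Sum using (_⊎_)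
open import Data.Empty using (⊥)
open import Data.Unit using (⊤)
open import Relation.Nullary using (¬_; Dec; yes; no; does)
open import Relation.Nullary.Decidable using (_×-dec_; _⊎-dec_; ¬?)
open import Relation.Binary.PropositionalEquality using (_≡_)
import Data.List.Sort.InsertionSort.Base as IS

data Decreasing : List ℕ → Set where
  []  : Decreasing []
  [-] : ∀ {x} → Decreasing (x ∷ [])
  _∷_ : ∀ {x y ys} → y ≤ x → Decreasing (y ∷ ys) → Decreasing (x ∷ y ∷ ys)

IsPartition : List ℕ → Set
IsPartition la = Decreasing la × All (λ x → 0 < x) la

-- Cells (i , j); rows and columns are 1-indexed (cells of λ have i,j ≥ 1).
Cell : Set
Cell = ℕ × ℕ

_≟c_ : (u v : Cell) → Dec (u ≡ v)
_≟c_ = ≡-dec ℕP._≟_ ℕP._≟_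

nc ec sc wc : Cell → Cell
nc (i , j) = (i ∸ 1 , j)
ec (i , j) = (i , suc j)
sc (i , j) = (suc i , j)
wc (i , j) = (i , j ∸ 1)

-- λ_i (0 if i = 0 or i > r)
rowLen : List ℕ → ℕ → ℕ
rowLen []       i             = 0
rowLen (x ∷ xs) zero          = 0
rowLen (x ∷ xs) (suc zero)    = x
rowLen (x ∷ xs) (suc (suc i)) = rowLen xs (suc i)

-- λ'_j (the conjugate partition), for j ≥ 1
colLen : List ℕ → ℕ → ℕ
colLen la j = length (filter (λ x → j ≤? x) la)

_∈λ_ : Cell → List ℕ → Set
(i , j) ∈λ la = 1 ≤ i × 1 ≤ j × j ≤ rowLen la i

_∈λ?_ : (u : Cell) → (la : List ℕ) → Dec (u ∈λ la)
(i , j) ∈λ? la = (1 ≤? i) ×-dec ((1 ≤? j) ×-dec (j ≤? rowLen la i))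

cells : List ℕ → List Cell
cells la = concatMap (λ i → map (λ j → (suc i , suc j)) (upTo (rowLen la (suc i))))
                     (upTo (length la))

-- Reverse plane partitions (as functions on cells; values outside λ
-- are irrelevant, the conventions 0 / ∞ are encoded in the conditions)

RPP : Set
RPP = Cell → ℕ

IsRPP : List ℕ → RPP → Set
IsRPP la π = ∀ u → u ∈λ la →
  (ec u ∈λ la → π u ≤ π (ec u)) × (sc u ∈λ la → π u ≤ π (sc u))

zeroRPP : RPP
zeroRPP _ = 0

_≐[_]_ : RPP → List ℕ → RPP → Set
π ≐[ la ] σ = ∀ u → u ∈λ la → π u ≡ σ u

content : Cell → ℤ
content (i , j) = j ⊖ i

IsOuterCorner : List ℕ → Cell → Set
IsOuterCorner la u = u ∈λ la × ¬ (ec u ∈λ la) × ¬ (sc u ∈λ la)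

IsInnerCorner : List ℕ → Cell → Set
IsInnerCorner la u = u ∈λ la × ec u ∈λ la × sc u ∈λ la × ¬ (ec (sc u) ∈λ la)

outer? : (la : List ℕ) → (u : Cell) → Dec (IsOuterCorner la u)
outer? la u = (u ∈λ? la) ×-dec (¬? (ec u ∈λ? la) ×-dec ¬? (sc u ∈λ? la))

inner? : (la : List ℕ) → (u : Cell) → Dec (IsInnerCorner la u)
inner? la u = (u ∈λ? la) ×-dec ((ec u ∈λ? la) ×-dec ((sc u ∈λ? la) ×-dec ¬? (ec (sc u) ∈λ? la)))

open IS ℤP.≤-decTotalOrder using (sort)

innerContents : List ℕ → List ℤ
innerContents la = sort (map content (filter (inner? la) (cells la)))

outerContents : List ℕ → List ℤ
outerContents la = sort (map content (filter (outer? la) (cells la)))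

InI-content : ℤ → List ℤ → Set
InI-content c []       = ⊥
InI-content c (x ∷ xs) = c ≡ x ⊎ InI-content c xs

-- ∃ k ∈ [r]. i_k < c < o_{k+1}   (arguments: i_1..i_r and o_2..o_{r+1})
InA-aux : ℤ → List ℤ → List ℤ → Set
InA-aux c (i ∷ is) (o ∷ os) = (i <ℤ c × c <ℤ o) ⊎ InA-aux c is os
InA-aux c _        _        = ⊥

InA-content : ℤ → List ℤ → List ℤ → Set
InA-content c is []       = ⊥
InA-content c is (o ∷ os) = c <ℤ o ⊎ InA-aux c is os

InB-content : ℤ → List ℤ → List ℤ → Set
InB-content c (o ∷ []) []       = o <ℤ c
InB-content c (o ∷ os) (i ∷ is) = (o <ℤ c × c <ℤ i) ⊎ InB-content c os is
InB-content c _        _        = ⊥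

InI-content? : (c : ℤ) → (xs : List ℤ) → Dec (InI-content c xs)
InI-content? c []       = no (λ ())
InI-content? c (x ∷ xs) = (c ℤP.≟ x) ⊎-dec InI-content? c xs

InB-content? : (c : ℤ) → (os is : List ℤ) → Dec (InB-content c os is)
InB-content? c []            is       = no (λ ())
InB-content? c (o ∷ [])      []       = o <ℤ? c
InB-content? c (o ∷ [])      (i ∷ is) = ((o <ℤ? c) ×-dec (c <ℤ? i)) ⊎-dec InB-content? c [] is
InB-content? c (o ∷ p ∷ os)  []       = no (λ ())
InB-content? c (o ∷ p ∷ os)  (i ∷ is) = ((o <ℤ? c) ×-dec (c <ℤ? i)) ⊎-dec InB-content? c (p ∷ os) is

InI : List ℕ → Cell → Set
InI la u = u ∈λ la × InI-content (content u) (innerContents la)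

InO : List ℕ → Cell → Set
InO la u = u ∈λ la × InI-content (content u) (outerContents la)

InA : List ℕ → Cell → Set
InA la u = u ∈λ la × InA-content (content u) (innerContents la) (outerContents la)

InB : List ℕ → Cell → Set
InB la u = u ∈λ la × InB-content (content u) (outerContents la) (innerContents la)

InBI? : (la : List ℕ) → (u : Cell) → Dec (InB la u ⊎ InI la u)
InBI? la u = ((u ∈λ? la) ×-dec InB-content? (content u) (outerContents la) (innerContents la))
       ⊎-dec ((u ∈λ? la) ×-dec InI-content? (content u) (innerContents la))

Path : Set
Path = List⁺ Cell

ℓ : Path → ℕ
ℓ (u ∷ us) = length us

data NESteps (la : List ℕ) : Cell → List Cell → Set where
  done : ∀ {u} → NESteps la u []
  step : ∀ {u v vs} → (v ≡ nc u ⊎ v ≡ ec u) → v ∈λ la → NESteps la v vs →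
         NESteps la u (v ∷ vs)

IsNEPath : List ℕ → Path → Set
IsNEPath la (u ∷ us) = u ∈λ la × NESteps la u us

αNE ωNE : Path → Cell
αNE = head
ωNE = last

_∈P_ : Cell → Path → Set
u ∈P P = u ∈ toList P

_∈P?_ : (u : Cell) → (P : Path) → Dec (u ∈P P)
u ∈P? P = Data.List.Membership.DecPropositional._∈?_ _≟c_ u (toList P)
  where import Data.List.Membership.DecPropositional

_+P_ : RPP → Path → RPP
(π +P P) u = if does (u ∈P? P) then suc (π u) else π u

IsRimHook : List ℕ → Path → Set
IsRimHook la h = IsNEPath la h
  × ¬ (sc (αNE h) ∈λ la) × ¬ (ec (ωNE h) ∈λ la)
  × (∀ u → u ∈P h → ¬ (ec (sc u) ∈λ la))

IsHookOf : List ℕ → Cell → Path → Set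
IsHookOf la (i , j) h = IsRimHook la h × αNE h ≡ (colLen la j , j) × ωNE h ≡ (i , rowLen la i)

_≤rl_ : Cell → Cell → Set
(i , j) ≤rl (k , l) = j > l ⊎ (j ≡ l × i ≥ k)

_≤h[_]_ : Path → List ℕ → Path → Set
h ≤h[ la ] h' = ∃[ u ] ∃[ v ] (u ∈λ la × v ∈λ la × IsHookOf la u h × IsHookOf la v h' × u ≤rl v)

Compatible : List ℕ → Path → RPP → Set
Compatible la P π =
  (∀ u → u ∈P P → (InI la u ⊎ InA la u) → ec u ∈P P × π u ≡ π (ec u))
  × (∀ u → u ∈P P → sc u ∈P P → π u ≡ π (sc u))

Inserts : List ℕ → Path → RPP → Set
Inserts la h π = ∃[ P ] (IsNEPath la P × ωNE P ≡ ωNE h × ℓ P ≡ ℓ h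
                         × Compatible la P π × IsRPP la (π +P P))

-- one step of the construction of P(h, π): move s if u ∈ B ∪ I and
-- π(u) = π(s u) (with π(s u) = ∞ when s u ∉ λ), otherwise w
nextCell : List ℕ → RPP → Cell → Cell
nextCell la π u with InBI? la u | sc u ∈λ? la | π u ℕP.≟ π (sc u)
... | yes _ | yes _ | yes _ = sc u
... | _     | _     | _     = wc u

buildSW : List ℕ → RPP → ℕ → Cell → Path
buildSW la π zero    u = u ∷ []
buildSW la π (suc k) u = u ∷ toList (buildSW la π k (nextCell la π u))

Pof : List ℕ → Path → RPP → Path
Pof la h π = buildSW la π (ℓ h) (ωNE h)

_*[_]_ : Path → List ℕ → RPP → RPP
h *[ la ] π = π +P Pof la h π

insertAll : List ℕ → List Path → RPP
insertAll la hs = foldr (λ h σ → h *[ la ] σ) zeroRPP hs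

ValidChain : List ℕ → List Path → Set
ValidChain la []       = ⊤
ValidChain la (h ∷ hs) = Inserts la h (insertAll la hs) × ValidChain la hs

SortedHooks : List ℕ → List Path → Set
SortedHooks la hs = All (IsRimHook la) hs × Linked (λ h h' → h ≤h[ la ] h') hs

{-# OPTIONS --safe #-}
module Submission where

-- Along each diagonal π is a partition; consecutive diagonals interlace, and the step of
-- the rim between them is vertical (rows) or horizontal (columns).  A hook of (i , j) occupies
-- the diagonals from the horizontal step of column j to the vertical step of row i, and its
-- insertion adds a box to each of these partitions, in rows determined by a bumping rule.
-- The rule can be read backwards from π + P, so the path is determined by its first cell, a cell
-- u with π (w u) < π u behind a horizontal step.  Always removing the path of the last such column
-- and, within it, of the lowest such cell gives the inverse: successive paths with the same
-- column do not cross, so their ends are weakly ordered, which is exactly the order of the hooks.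
open import Defs
open import Data.Bool using (if_then_else_)
open import Data.Empty using (⊥; ⊥-elim)
open import Data.Integer using (ℤ; _⊖_) renaming (_<_ to _<ℤ_)
import Data.Integer.Properties as ℤ
open import Data.List using (List; []; _∷_; filter; initLast; length; map; upTo)
import Data.List as List
open import Data.List.Membership.Propositional using (_∈_; lose)
open import Data.List.Membership.Propositional.Properties
  using (∈-concatMap⁺; ∈-filter⁺; ∈-filter⁻; ∈-map⁺; ∈-map⁻; ∈-upTo⁺)
open import Data.List.Membership.Propositional.Properties.WithK using (unique∧set⇒bag)
open import Data.List.NonEmpty as List⁺ using (last; toList)
open import Data.List.Properties using (filter-accept; filter-reject)
open import Data.List.Relation.Binary.BagAndSetEquality using (∼bag⇒↭)
open import Data.List.Relation.Binary.Disjoint.Propositional using (Disjoint)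
open import Data.List.Relation.Binary.Permutation.Propositional using (↭-trans; ↭⇒↭ₛ)
open import Data.List.Relation.Binary.Pointwise using (Pointwise-≡⇒≡)
open import Data.List.Relation.Unary.All as All using (All)
import Data.List.Relation.Unary.All.Properties as All
open import Data.List.Relation.Unary.AllPairs as AllPairs using (AllPairs)
import Data.List.Relation.Unary.AllPairs.Properties as AllPairs
open import Data.List.Relation.Unary.Any using (here; there)
open import Data.List.Relation.Unary.Linked as Linked using (Linked)
import Data.List.Relation.Unary.Sorted.TotalOrder.Properties as Sorted
open import Data.List.Relation.Unary.Unique.Propositional using (Unique)
import Data.List.Relation.Unary.Unique.Propositional.Properties as Unique
import Data.List.Sort.InsertionSort.Base as InsertionSort
import Data.List.Sort.InsertionSort.Properties as InsertionSortProperties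
open import Data.Nat using (ℕ; zero; suc; pred; _+_; _∸_; _≤_; _<_; z≤n; s≤s; _≤?_; _<?_)
open import Data.Nat.GeneralisedArithmetic using (fold)
open import Data.Nat.ListAction using (sum)
open import Data.Nat.Properties
open import Data.Nat.Tactic.RingSolver using (solve)
open import Data.Product using (_×_; _,_; proj₁; proj₂; ∃-syntax; Σ-syntax)
open import Data.Sum using (_⊎_; inj₁; inj₂)
open import Data.Unit using (tt)
open import Function using (_∘_; case_of_; mk⇔)
open import Relation.Binary.Definitions using (tri<; tri≈; tri>)
open import Relation.Binary.PropositionalEquality
open import Relation.Nullary using (¬_; Dec; yes; no; does)
open import Relation.Nullary.Decidable using (_×-dec_; dec-false; dec-true; map′)

-- The classes of the statement are conditions on steps of the rim: `B ∪ I` consists of the cells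
-- whose diagonal is entered by a vertical step, and on `A ∪ I` the step leaving the diagonal is not
-- vertical. Both the path construction and compatibility thus become statements about `Vert` and
-- `Horiz`. The rule can be reversed because a path meets each diagonal once. After a west step on a
-- vertical diagonal the cell reached has grown and its north neighbour has not, so the two entries
-- differ; after a south step they agree. The obstacle is that nothing in the forward rule itself
-- keeps the path from running off the west side of the shape. The order of the hooks prevents it:
-- either nothing can be extracted from the columns from j on, and then the diagonals have few
-- nonzero entries, or the previous hook had the same column, and its path bounds the new one. The
-- same bound makes the new west end extremal. The record `Extract` is the hinge: it speaks of one
-- filling only, is produced by every admissible insertion, and determines the hook and the path
-- that were used.

infixl 6 _⊕_
_⊕_ : ∀ {a b c d} → a ≤ b → c ≤ d → a + c ≤ b + d
_⊕_ = +-mono-≤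

-- Three certificate checkers for linear arithmetic: the hypotheses are
-- added up to `A ≤ B`, and the goal follows by a semiring identity with slack k.
lin-⊥ : ∀ {A B} → A ≤ B → ∀ k → A ≡ suc (k + B) → ⊥
lin-⊥ {A} {B} A≤B k eq = <-irrefl refl (≤-trans (s≤s (m≤n+m B k)) (subst (_≤ B) eq A≤B))

lin-≤ : ∀ {A B} x y → A ≤ B → ∀ k → B + x + k ≡ A + y → x ≤ y
lin-≤ {A} {B} x y A≤B k eq = +-cancelˡ-≤ B x y (begin
  B + x     ≤⟨ m≤m+n (B + x) k ⟩
  B + x + k ≡⟨ eq ⟩
  A + y     ≤⟨ +-monoˡ-≤ y A≤B ⟩
  B + y     ∎)
  where open ≤-Reasoning

lin-≡ : ∀ {A B} x y → A ≡ B → x + B ≡ y + A → x ≡ y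
lin-≡ {A} x y refl eq = +-cancelʳ-≡ A x y eq

-- Row lengths and column lengths of a partition.

rowLen-tail≤head : ∀ {x xs} → Decreasing (x ∷ xs) → ∀ i → rowLen xs i ≤ x
rowLen-tail≤head {xs = []}     _       i             = z≤n
rowLen-tail≤head {xs = y ∷ ys} _       zero          = z≤n
rowLen-tail≤head {xs = y ∷ ys} (p ∷ _) (suc zero)    = p
rowLen-tail≤head {xs = y ∷ ys} (p ∷ d) (suc (suc i)) = ≤-trans (rowLen-tail≤head d (suc i)) p

decreasing-tail : ∀ {x xs} → Decreasing (x ∷ xs) → Decreasing xs
decreasing-tail [-]     = []
decreasing-tail (_ ∷ d) = d

colLen-beyond : ∀ la → Decreasing la → ∀ j → rowLen la 1 < j → colLen la j ≡ 0
colLen-beyond []       d j p = refl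
colLen-beyond (x ∷ xs) d j p rewrite filter-reject (λ z → j ≤? z) {x} {xs} (<⇒≱ p) =
  colLen-beyond xs (decreasing-tail d) j (≤-<-trans (rowLen-tail≤head d 1) p)

colLen-accept : ∀ x xs j → j ≤ x → colLen (x ∷ xs) j ≡ suc (colLen xs j)
colLen-accept x xs j p rewrite filter-accept (λ z → j ≤? z) {x} {xs} p = refl

row⇒col : ∀ la → Decreasing la → ∀ i j → 1 ≤ i → 1 ≤ j → j ≤ rowLen la i → i ≤ colLen la j
row⇒col [] d i (suc j) 1≤i 1≤j ()
row⇒col (x ∷ xs) d (suc zero) j _ 1≤j j≤ rewrite colLen-accept x xs j j≤ = s≤s z≤n
row⇒col (x ∷ xs) d (suc (suc i)) j _ 1≤j j≤
  rewrite colLen-accept x xs j (≤-trans j≤ (rowLen-tail≤head d (suc i))) =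
  s≤s (row⇒col xs (decreasing-tail d) (suc i) j (s≤s z≤n) 1≤j j≤)

col⇒row : ∀ la → Decreasing la → ∀ i j → 1 ≤ i → i ≤ colLen la j → j ≤ rowLen la i
col⇒row [] d (suc i) j _ ()
col⇒row (x ∷ xs) d i j 1≤i i≤ with j ≤? x
col⇒row (x ∷ xs) d (suc zero) j 1≤i i≤ | yes p = p
col⇒row (x ∷ xs) d (suc (suc i)) j 1≤i i≤ | yes p =
  col⇒row xs (decreasing-tail d) (suc i) j (s≤s z≤n) (≤-pred (subst (suc (suc i) ≤_) (colLen-accept x xs j p) i≤))
col⇒row (x ∷ xs) d i j 1≤i i≤ | no ¬p =
  ⊥-elim (<⇒≱ 1≤i (subst (i ≤_) (colLen-beyond (x ∷ xs) d j (≰⇒> ¬p)) i≤))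

rowLen-anti : ∀ la → Decreasing la → ∀ {i i′} → 1 ≤ i → i ≤ i′ → rowLen la i′ ≤ rowLen la i
rowLen-anti [] d _ _ = z≤n
rowLen-anti (x ∷ xs) d {suc zero} {suc zero} _ _ = ≤-refl
rowLen-anti (x ∷ xs) d {suc zero} {suc (suc i′)} _ _ = rowLen-tail≤head d (suc i′)
rowLen-anti (x ∷ xs) d {suc (suc i)} {suc (suc i′)} _ (s≤s p) = rowLen-anti xs (decreasing-tail d) (s≤s z≤n) p

colLen-anti : ∀ la → Decreasing la → ∀ {j j′} → 1 ≤ j → j ≤ j′ → colLen la j′ ≤ colLen la j
colLen-anti la d {j} {j′} 1≤j j≤j′ with colLen la j′ in eq
... | zero  = z≤n
... | suc i = row⇒col la d (suc i) j (s≤s z≤n) 1≤j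
  (≤-trans j≤j′ (col⇒row la d (suc i) j′ (s≤s z≤n) (≤-reflexive (sym eq))))

-- Corner contents read along the boundary word.

open InsertionSort ℤ.≤-decTotalOrder using (sort)
open InsertionSortProperties ℤ.≤-decTotalOrder using (sort-↗; sort-↭)

-- Duplicate-free lists with the same members are permutations of each other, and a total order
-- admits only one sorted arrangement. This replaces the sorted corner contents by a list produced
-- in boundary order.
sort-unique : ∀ {xs ys : List ℤ} → Unique xs → AllPairs _<ℤ_ ys →
  (∀ {z} → z ∈ xs → z ∈ ys) → (∀ {z} → z ∈ ys → z ∈ xs) → sort xs ≡ ys
sort-unique {xs} {ys} uxs ys< to from = Pointwise-≡⇒≡ (Sorted.↗↭↗⇒≋ ℤ.≤-totalOrder (sort-↗ xs)
  (Sorted.AllPairs⇒Sorted ℤ.≤-totalOrder (AllPairs.map ℤ.<⇒≤ ys<))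
  (↭⇒↭ₛ (↭-trans (sort-↭ xs)
    (∼bag⇒↭ (unique∧set⇒bag uxs (AllPairs.map ℤ.<⇒≢ ys<) (mk⇔ to from))))))

InB-∷⁻ : ∀ c o os i is → InB-content c (o ∷ os) (i ∷ is) → (o <ℤ c × c <ℤ i) ⊎ InB-content c os is
InB-∷⁻ c o []      i is p = p
InB-∷⁻ c o (_ ∷ _) i is p = p

InB-∷⁺ : ∀ c o os i is → (o <ℤ c × c <ℤ i) ⊎ InB-content c os is → InB-content c (o ∷ os) (i ∷ is)
InB-∷⁺ c o []      i is p = p
InB-∷⁺ c o (_ ∷ _) i is p = p

-- S k says that the boundary step leading to the k-th diagonal is vertical; an outer
-- corner is a change from horizontal to vertical, an inner corner the opposite change.
module Corners (S : ℕ → Set) (c : ℕ → ℤ) (c-mono : ∀ {k l} → k < l → c k <ℤ c l) where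

  c-cancel-< : ∀ {k l} → c k <ℤ c l → k < l
  c-cancel-< {k} {l} p with k <? l
  ... | yes q = q
  ... | no ¬q with m≤n⇒m<n∨m≡n (≮⇒≥ ¬q)
  ...   | inj₁ r    = ⊥-elim (ℤ.<-asym p (c-mono r))
  ...   | inj₂ refl = ⊥-elim (ℤ.<-irrefl refl p)

  c-injective : ∀ {k l} → c k ≡ c l → k ≡ l
  c-injective {k} {l} eq with <-cmp k l
  ... | tri< p _ _ = ⊥-elim (ℤ.<-irrefl eq (c-mono p))
  ... | tri≈ _ p _ = p
  ... | tri> _ _ p = ⊥-elim (ℤ.<-irrefl (sym eq) (c-mono p))

  -- One constructor for each pair of consecutive steps. Recursion on it keeps track of which of
  -- `os` and `is` supplies the next corner, and the content conditions for A and B consume the two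
  -- lists in the same alternation.
  data Scan : ℕ → ℕ → List ℕ → List ℕ → Set where
    done  : ∀ {k} → Scan k 0 [] []
    outer : ∀ {k n os is} → ¬ S k → S (suc k) → Scan (suc k) n os is → Scan k (suc n) (k ∷ os) is
    inner : ∀ {k n os is} → S k → ¬ S (suc k) → Scan (suc k) n os is → Scan k (suc n) os (k ∷ is)
    vert  : ∀ {k n os is} → S k → S (suc k) → Scan (suc k) n os is → Scan k (suc n) os is
    horiz : ∀ {k n os is} → ¬ S k → ¬ S (suc k) → Scan (suc k) n os is → Scan k (suc n) os is

  scan : (∀ k → Dec (S (suc k))) → ∀ k n → ∃[ os ] (∃[ is ] (Scan (suc k) n os is))
  scan S? k zero = [] , [] , done
  scan S? k (suc n) with S? k | S? (suc k) | scan S? (suc k) n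
  ... | no p  | yes q | os , is , s = suc k ∷ os , is , outer p q s
  ... | yes p | no q  | os , is , s = os , suc k ∷ is , inner p q s
  ... | yes p | yes q | os , is , s = os , is , vert p q s
  ... | no p  | no q  | os , is , s = os , is , horiz p q s

  os-≥ : ∀ {k n os is} → Scan k n os is → All (k ≤_) os
  os-≥ done          = All.[]
  os-≥ (outer _ _ s) = ≤-refl All.∷ All.map <⇒≤ (os-≥ s)
  os-≥ (inner _ _ s) = All.map <⇒≤ (os-≥ s)
  os-≥ (vert _ _ s)  = All.map <⇒≤ (os-≥ s)
  os-≥ (horiz _ _ s) = All.map <⇒≤ (os-≥ s)

  is-≥ : ∀ {k n os is} → Scan k n os is → All (k ≤_) is
  is-≥ done          = All.[]
  is-≥ (outer _ _ s) = All.map <⇒≤ (is-≥ s)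
  is-≥ (inner _ _ s) = ≤-refl All.∷ All.map <⇒≤ (is-≥ s)
  is-≥ (vert _ _ s)  = All.map <⇒≤ (is-≥ s)
  is-≥ (horiz _ _ s) = All.map <⇒≤ (is-≥ s)

  os-< : ∀ {k n os is} → Scan k n os is → AllPairs _<ℤ_ (map c os)
  os-< s = AllPairs.map⁺ (AllPairs.map c-mono (go s))
    where
    go : ∀ {k n os is} → Scan k n os is → AllPairs _<_ os
    go done          = AllPairs.[]
    go (outer _ _ s) = os-≥ s AllPairs.∷ go s
    go (inner _ _ s) = go s
    go (vert _ _ s)  = go s
    go (horiz _ _ s) = go s

  is-< : ∀ {k n os is} → Scan k n os is → AllPairs _<ℤ_ (map c is)
  is-< s = AllPairs.map⁺ (AllPairs.map c-mono (go s))
    where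
    go : ∀ {k n os is} → Scan k n os is → AllPairs _<_ is
    go done          = AllPairs.[]
    go (outer _ _ s) = go s
    go (inner _ _ s) = is-≥ s AllPairs.∷ go s
    go (vert _ _ s)  = go s
    go (horiz _ _ s) = go s

  private
    widen : ∀ {A : ℕ → Set} {k n d} → (suc k ≤ d × d < suc k + n × A d) → (k ≤ d × d < k + suc n × A d)
    widen {k = k} {n} {d} (p , q , a) = <⇒≤ p , subst (d <_) (sym (+-suc k n)) q , a

  os-∈⁻ : ∀ {k n os is d} → Scan k n os is → d ∈ os → k ≤ d × d < k + n × ¬ S d × S (suc d)
  os-∈⁻ {k} (outer {n = n} p q s) (here refl) = ≤-refl , m<m+n k (s≤s z≤n) , p , q
  os-∈⁻ (outer _ _ s) (there m) = widen {λ d → ¬ S d × S (suc d)} (os-∈⁻ s m)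
  os-∈⁻ (inner _ _ s) m = widen {λ d → ¬ S d × S (suc d)} (os-∈⁻ s m)
  os-∈⁻ (vert _ _ s)  m = widen {λ d → ¬ S d × S (suc d)} (os-∈⁻ s m)
  os-∈⁻ (horiz _ _ s) m = widen {λ d → ¬ S d × S (suc d)} (os-∈⁻ s m)

  is-∈⁻ : ∀ {k n os is d} → Scan k n os is → d ∈ is → k ≤ d × d < k + n × S d × ¬ S (suc d)
  is-∈⁻ {k} (inner {n = n} p q s) (here refl) = ≤-refl , m<m+n k (s≤s z≤n) , p , q
  is-∈⁻ (inner _ _ s) (there m) = widen {λ d → S d × ¬ S (suc d)} (is-∈⁻ s m)
  is-∈⁻ (outer _ _ s) m = widen {λ d → S d × ¬ S (suc d)} (is-∈⁻ s m)
  is-∈⁻ (vert _ _ s)  m = widen {λ d → S d × ¬ S (suc d)} (is-∈⁻ s m)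
  is-∈⁻ (horiz _ _ s) m = widen {λ d → S d × ¬ S (suc d)} (is-∈⁻ s m)

  private
    head-or-later : ∀ {k n d} → k ≤ d → d < k + suc n → k ≡ d ⊎ (suc k ≤ d × d < suc k + n)
    head-or-later {k} {n} {d} k≤d d< with m≤n⇒m<n∨m≡n k≤d
    ... | inj₂ eq = inj₁ eq
    ... | inj₁ lt = inj₂ (lt , subst (d <_) (+-suc k n) d<)

    empty : ∀ {k d} → k ≤ d → d < k + 0 → ⊥
    empty {k} p q = <⇒≱ (subst (_ <_) (+-identityʳ k) q) p

  os-∈⁺ : ∀ {k n os is d} → Scan k n os is → k ≤ d → d < k + n → ¬ S d → S (suc d) → d ∈ os
  os-∈⁺ done p q _ _ = ⊥-elim (empty p q)
  os-∈⁺ (outer a b s) p q x y with head-or-later p q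
  ... | inj₁ refl      = here refl
  ... | inj₂ (p′ , q′) = there (os-∈⁺ s p′ q′ x y)
  os-∈⁺ (inner a b s) p q x y with head-or-later p q
  ... | inj₁ refl      = ⊥-elim (x a)
  ... | inj₂ (p′ , q′) = os-∈⁺ s p′ q′ x y
  os-∈⁺ (vert a b s) p q x y with head-or-later p q
  ... | inj₁ refl      = ⊥-elim (x a)
  ... | inj₂ (p′ , q′) = os-∈⁺ s p′ q′ x y
  os-∈⁺ (horiz a b s) p q x y with head-or-later p q
  ... | inj₁ refl      = ⊥-elim (b y)
  ... | inj₂ (p′ , q′) = os-∈⁺ s p′ q′ x y

  is-∈⁺ : ∀ {k n os is d} → Scan k n os is → k ≤ d → d < k + n → S d → ¬ S (suc d) → d ∈ is
  is-∈⁺ done p q _ _ = ⊥-elim (empty p q)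
  is-∈⁺ (inner a b s) p q x y with head-or-later p q
  ... | inj₁ refl      = here refl
  ... | inj₂ (p′ , q′) = there (is-∈⁺ s p′ q′ x y)
  is-∈⁺ (outer a b s) p q x y with head-or-later p q
  ... | inj₁ refl      = ⊥-elim (a x)
  ... | inj₂ (p′ , q′) = is-∈⁺ s p′ q′ x y
  is-∈⁺ (vert a b s) p q x y with head-or-later p q
  ... | inj₁ refl      = ⊥-elim (y b)
  ... | inj₂ (p′ , q′) = is-∈⁺ s p′ q′ x y
  is-∈⁺ (horiz a b s) p q x y with head-or-later p q
  ... | inj₁ refl      = ⊥-elim (a x)
  ... | inj₂ (p′ , q′) = is-∈⁺ s p′ q′ x y

  BI AI : ℕ → List ℕ → List ℕ → Set
  BI d os is = InB-content (c d) (map c os) (map c is) ⊎ InI-content (c d) (map c is)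
  AI d os is = InA-content (c d) (map c is) (map c os) ⊎ InI-content (c d) (map c is)

  private
    no-I : ∀ {d is} → All (suc d ≤_) is → ¬ InI-content (c d) (map c is)
    no-I (p All.∷ ps) (inj₁ eq) = <-irrefl (c-injective eq) p
    no-I (p All.∷ ps) (inj₂ q)  = no-I ps q

    no-B : ∀ {d os is} → All (d ≤_) os → ¬ InB-content (c d) (map c os) (map c is)
    no-B {os = o ∷ []}     {[]}     (p All.∷ ps) q = <⇒≱ (c-cancel-< q) p
    no-B {d} {o ∷ os}      {i ∷ is} (p All.∷ ps) q with InB-∷⁻ (c d) (c o) (map c os) (c i) (map c is) q
    ... | inj₁ (r , _) = <⇒≱ (c-cancel-< r) p
    ... | inj₂ r       = no-B {d} {os} {is} ps r

    no-A : ∀ {d} is os → All (d ≤_) is → ¬ InA-aux (c d) (map c is) (map c os)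
    no-A (i ∷ is) (o ∷ os) (p All.∷ ps) (inj₁ (q , _)) = <⇒≱ (c-cancel-< q) p
    no-A (i ∷ is) (o ∷ os) (p All.∷ ps) (inj₂ q)       = no-A is os ps q

    no-inner : ∀ {k n os} → S k → Scan k n os [] → os ≡ []
    no-inner sk done          = refl
    no-inner sk (outer a _ _) = ⊥-elim (a sk)
    no-inner sk (vert _ b s)  = no-inner b s
    no-inner sk (horiz a _ _) = ⊥-elim (a sk)

  -- The versions with o read the lists behind an outer corner o that has been passed already.
  mutual
    BI-sound : ∀ {k n os is d} → Scan k n os is → k ≤ d → d < k + n → ¬ S k → BI d os is → S d
    BI-sound done p q _ _ = ⊥-elim (empty p q)
    BI-sound (inner a _ _) p q ¬sk _ = ⊥-elim (¬sk a)
    BI-sound (vert a _ _) p q ¬sk _ = ⊥-elim (¬sk a)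
    BI-sound {os = o ∷ os} {is} (outer a b s) p q ¬sk h with head-or-later p q | h
    ... | inj₁ refl | inj₁ r = ⊥-elim (no-B {os = o ∷ os} {is} (≤-refl All.∷ All.map <⇒≤ (os-≥ s)) r)
    ... | inj₁ refl | inj₂ r = ⊥-elim (no-I (is-≥ s) r)
    ... | inj₂ (p′ , q′) | _ = BI-sound-o s p′ q′ b h
    BI-sound {os = os} {is} (horiz a b s) p q ¬sk h with head-or-later p q | h
    ... | inj₁ refl | inj₁ r = ⊥-elim (no-B {os = os} {is} (All.map <⇒≤ (os-≥ s)) r)
    ... | inj₁ refl | inj₂ r = ⊥-elim (no-I (is-≥ s) r)
    ... | inj₂ (p′ , q′) | _ = BI-sound s p′ q′ b h

    BI-sound-o : ∀ {k n os is d o} → Scan k n os is → k ≤ d → d < k + n → S k → BI d (o ∷ os) is → S d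
    BI-sound-o done p q _ _ = ⊥-elim (empty p q)
    BI-sound-o (outer a _ _) p q sk _ = ⊥-elim (a sk)
    BI-sound-o (horiz a _ _) p q sk _ = ⊥-elim (a sk)
    BI-sound-o (vert a b s) p q sk h with head-or-later p q
    ... | inj₁ refl      = sk
    ... | inj₂ (p′ , q′) = BI-sound-o s p′ q′ b h
    BI-sound-o {k} {os = os} {_ ∷ is} {d} {o} (inner a b s) p q sk h with head-or-later p q | h
    ... | inj₁ refl | _ = sk
    ... | inj₂ (p′ , q′) | inj₂ (inj₁ eq) = ⊥-elim (<-irrefl (sym (c-injective eq)) p′)
    ... | inj₂ (p′ , q′) | inj₂ (inj₂ r)  = BI-sound s p′ q′ b (inj₂ r)
    ... | inj₂ (p′ , q′) | inj₁ r with InB-∷⁻ (c d) (c o) (map c os) (c k) (map c is) r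
    ...   | inj₁ (_ , lt) = ⊥-elim (<-asym (c-cancel-< lt) p′)
    ...   | inj₂ r′       = BI-sound s p′ q′ b (inj₁ r′)

  mutual
    BI-complete : ∀ {k n os is d} → Scan k n os is → k ≤ d → d < k + n → ¬ S k → S d → BI d os is
    BI-complete done p q _ _ = ⊥-elim (empty p q)
    BI-complete (inner a _ _) p q ¬sk _ = ⊥-elim (¬sk a)
    BI-complete (vert a _ _) p q ¬sk _ = ⊥-elim (¬sk a)
    BI-complete (outer a b s) p q ¬sk h with head-or-later p q
    ... | inj₁ refl      = ⊥-elim (a h)
    ... | inj₂ (p′ , q′) = BI-complete-o s ≤-refl p′ q′ b h
    BI-complete (horiz a b s) p q ¬sk h with head-or-later p q
    ... | inj₁ refl      = ⊥-elim (a h)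
    ... | inj₂ (p′ , q′) = BI-complete s p′ q′ b h

    BI-complete-o : ∀ {k n os is d o} → Scan k n os is → o < k → k ≤ d → d < k + n → S k → S d → BI d (o ∷ os) is
    BI-complete-o done _ p q _ _ = ⊥-elim (empty p q)
    BI-complete-o (outer a _ _) _ p q sk _ = ⊥-elim (a sk)
    BI-complete-o (horiz a _ _) _ p q sk _ = ⊥-elim (a sk)
    BI-complete-o {k} {os = os} {_ ∷ is} {d} {o} (inner a b s) o< p q sk h with head-or-later p q
    ... | inj₁ refl = inj₂ (inj₁ refl)
    ... | inj₂ (p′ , q′) with BI-complete s p′ q′ b h
    ...   | inj₁ r = inj₁ (InB-∷⁺ (c d) (c o) (map c os) (c k) (map c is) (inj₂ r))
    ...   | inj₂ r = inj₂ (inj₂ r)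
    BI-complete-o {k} {os = os} {is} {d} {o} (vert a b s) o< p q sk h with head-or-later p q
    ... | inj₂ (p′ , q′) = BI-complete-o s (m<n⇒m<1+n o<) p′ q′ b h
    -- With no inner corner left the word stays vertical to its end, so `o` is the last outer corner
    -- and the unbounded final clause of B applies.
    BI-complete-o {is = []} (vert a b s) o< p q sk h | inj₁ refl with no-inner b s
    ... | refl = inj₁ (c-mono o<)
    BI-complete-o {k} {os = os} {i ∷ is} {o = o} (vert a b s) o< p q sk h | inj₁ refl with is-≥ s
    ... | lt All.∷ _ = inj₁ (InB-∷⁺ (c k) (c o) (map c os) (c i) (map c is) (inj₁ (c-mono o< , c-mono lt)))

  mutual
    -- The intervals of `A ∪ I` run from an inner corner up to, but excluding, the next outer
    -- corner, which is a horizontal run. Past an inner corner the lower bound of the pending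
    -- interval holds automatically, so `InA-aux` turns back into the clause for an initial
    -- interval.
    AI-sound : ∀ {k n os is d} → Scan k n os is → k ≤ d → d < k + n → ¬ S k → AI d os is → ¬ S (suc d)
    AI-sound done p q _ _ = ⊥-elim (empty p q)
    AI-sound (inner a _ _) p q ¬sk _ = ⊥-elim (¬sk a)
    AI-sound (vert a _ _) p q ¬sk _ = ⊥-elim (¬sk a)
    AI-sound {os = o ∷ os} {is} (outer a b s) p q ¬sk h with head-or-later p q | h
    ... | _         | inj₁ (inj₁ lt) = ⊥-elim (<⇒≱ (c-cancel-< lt) p)
    ... | inj₁ refl | inj₁ (inj₂ r)  = ⊥-elim (no-A is os (All.map <⇒≤ (is-≥ s)) r)
    ... | inj₁ refl | inj₂ r         = ⊥-elim (no-I (is-≥ s) r)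
    ... | inj₂ (p′ , q′) | inj₁ (inj₂ r) = AI-sound-o s p′ q′ b (inj₁ r)
    ... | inj₂ (p′ , q′) | inj₂ r        = AI-sound-o s p′ q′ b (inj₂ r)
    AI-sound (horiz a b s) p q ¬sk h with head-or-later p q
    ... | inj₁ refl      = b
    ... | inj₂ (p′ , q′) = AI-sound s p′ q′ b h

    AI-sound-o : ∀ {k n os is d} → Scan k n os is → k ≤ d → d < k + n → S k →
      InA-aux (c d) (map c is) (map c os) ⊎ InI-content (c d) (map c is) → ¬ S (suc d)
    AI-sound-o done p q _ _ = ⊥-elim (empty p q)
    AI-sound-o (outer a _ _) p q sk _ = ⊥-elim (a sk)
    AI-sound-o (horiz a _ _) p q sk _ = ⊥-elim (a sk)
    AI-sound-o {os = os} {is} (vert a b s) p q sk h with head-or-later p q | h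
    ... | inj₁ refl | inj₁ r = ⊥-elim (no-A is os (All.map <⇒≤ (is-≥ s)) r)
    ... | inj₁ refl | inj₂ r = ⊥-elim (no-I (is-≥ s) r)
    ... | inj₂ (p′ , q′) | _ = AI-sound-o s p′ q′ b h
    AI-sound-o {os = os} (inner a b s) p q sk h with head-or-later p q | os | h
    ... | inj₁ refl      | _      | _                       = b
    ... | inj₂ (p′ , q′) | _      | inj₂ (inj₁ eq)          = ⊥-elim (<-irrefl (sym (c-injective eq)) p′)
    ... | inj₂ (p′ , q′) | _      | inj₂ (inj₂ r)           = AI-sound s p′ q′ b (inj₂ r)
    ... | inj₂ (p′ , q′) | o ∷ _  | inj₁ (inj₁ (_ , lt))    = AI-sound s p′ q′ b (inj₁ (inj₁ lt))
    ... | inj₂ (p′ , q′) | o ∷ _  | inj₁ (inj₂ r)           = AI-sound s p′ q′ b (inj₁ (inj₂ r))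

-- Steps of the rim and positions of diagonals.

module Shape (la : List ℕ) (part : IsPartition la) where

  L M : ℕ → ℕ
  L = rowLen la
  M = colLen la

  L-anti : ∀ {i i′} → 1 ≤ i → i ≤ i′ → L i′ ≤ L i
  L-anti = rowLen-anti la (proj₁ part)

  M-anti : ∀ {j j′} → 1 ≤ j → j ≤ j′ → M j′ ≤ M j
  M-anti = colLen-anti la (proj₁ part)

  L⇒M : ∀ {i j} → 1 ≤ i → 1 ≤ j → j ≤ L i → i ≤ M j
  L⇒M {i} {j} = row⇒col la (proj₁ part) i j

  M⇒L : ∀ {i j} → 1 ≤ i → i ≤ M j → j ≤ L i
  M⇒L {i} {j} = col⇒row la (proj₁ part) i j

  -- Vert u: the step of the rim that enters the diagonal of u from the south-west
  -- is vertical.  Horiz u j: it is horizontal and lies in column j.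
  Vert : Cell → Set
  Vert (x , y) = ∃[ i ] (1 ≤ i × L i + suc x ≡ y + i)

  Horiz : Cell → ℕ → Set
  Horiz (x , y) j = 1 ≤ j × j + x ≡ y + M j

  row : Cell → ℕ
  row = proj₁

  north-∈ : ∀ {x y} → (suc x , y) ∈λ la → 1 ≤ x → (x , y) ∈λ la
  north-∈ (_ , 1≤y , y≤) 1≤x = 1≤x , 1≤y , ≤-trans y≤ (L-anti 1≤x (n≤1+n _))

  west-∈ : ∀ {x y} → (x , suc y) ∈λ la → 1 ≤ y → (x , y) ∈λ la
  west-∈ (1≤x , _ , y≤) 1≤y = 1≤x , 1≤y , ≤-trans (n≤1+n _) y≤

  Vert-es : ∀ {x y} → Vert (x , y) → Vert (suc x , suc y)
  Vert-es {x} (i , 1≤i , eq) = i , 1≤i , trans (+-suc (L i) (suc x)) (cong suc eq)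

  Vert-nw : ∀ {x y} → Vert (suc x , suc y) → Vert (x , y)
  Vert-nw {x} (i , 1≤i , eq) = i , 1≤i , suc-injective (trans (sym (+-suc (L i) (suc x))) eq)

  Horiz-es : ∀ {x y j} → Horiz (x , y) j → Horiz (suc x , suc y) j
  Horiz-es {x} {j = j} (1≤j , eq) = 1≤j , trans (+-suc j x) (cong suc eq)

  Horiz-nw : ∀ {x y j} → Horiz (suc x , suc y) j → Horiz (x , y) j
  Horiz-nw {x} {j = j} (1≤j , eq) = 1≤j , suc-injective (trans (sym (+-suc j x)) eq)

  module _ where
    private
      meet : ∀ l m i j x y → l + suc x ≡ y + i → j + x ≡ y + m → j ≤ l → i ≤ m → ⊥
      meet l m i j x y p q r s = lin-⊥ (≤-reflexive p ⊕ ≤-reflexive (sym q) ⊕ r ⊕ s) 0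
        (solve (l ∷ m ∷ i ∷ j ∷ x ∷ y ∷ []))
      miss : ∀ l m i j x y → l + suc x ≡ y + i → j + x ≡ y + m → l < j → m < i → ⊥
      miss l m i j x y p q r s = lin-⊥ (≤-reflexive (sym p) ⊕ ≤-reflexive q ⊕ r ⊕ s) 0
        (solve (l ∷ m ∷ i ∷ j ∷ x ∷ y ∷ []))

    -- The classical disjointness of the numbers `L i - i + 1` and `j - M j`: if (i , j) lies in the
    -- shape the first is larger, since `j ≤ L i` and `i ≤ M j`; otherwise both inequalities are
    -- reversed strictly and the first is smaller.
    Vert-¬Horiz : ∀ {u j} → Vert u → Horiz u j → ⊥
    Vert-¬Horiz {x , y} {j} (i , 1≤i , p) (1≤j , q) with j ≤? L i
    ... | yes j≤ = meet (L i) (M j) i j x y p q j≤ (L⇒M 1≤i 1≤j j≤)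
    ... | no  j≰ = miss (L i) (M j) i j x y p q (≰⇒> j≰) (≰⇒> (λ i≤ → j≰ (M⇒L 1≤i i≤)))

    private
      long : ∀ l i x y → l + suc x ≡ y + i → y ≤ l → i ≤ x → ⊥
      long l i x y p q r = lin-⊥ (≤-reflexive p ⊕ q ⊕ r) 0 (solve (l ∷ i ∷ x ∷ y ∷ []))
      reach : ∀ l i x y → l + suc x ≡ y + i → x < i → y ≤ l
      reach l i x y p q = lin-≤ y l (≤-reflexive (sym p) ⊕ q) 0 (solve (l ∷ i ∷ x ∷ y ∷ []))

    -- The row of the vertical step lies strictly below u and reaches the column of u. Hence on such
    -- diagonals a south neighbour always exists, and the convention of infinite entries is never
    -- met.
    Vert-south : ∀ {u} → u ∈λ la → Vert u → sc u ∈λ la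
    Vert-south {x , y} (1≤x , 1≤y , y≤) (i , 1≤i , p) with i ≤? x
    ... | yes i≤x = ⊥-elim (long (L i) i x y p (≤-trans y≤ (L-anti 1≤i i≤x)) i≤x)
    ... | no  i≰x = s≤s z≤n , 1≤y , ≤-trans (reach (L i) i x y p (≰⇒> i≰x)) (L-anti (s≤s z≤n) (≰⇒> i≰x))

  private
    -- The step depends only on the diagonal, so u may be pushed south-east to the last cell of the
    -- shape. There the south neighbour decides: if it is present, the row below ends in it; if not,
    -- the column ends. The number g bounds the pushes.
    step-dichotomy : ∀ g {x y} → y + g ≡ L 1 → (x , y) ∈λ la → Vert (x , y) ⊎ ∃[ j ] Horiz (x , y) j
    step-dichotomy g {x} {y} eq u∈@(1≤x , 1≤y , y≤) with suc y ≤? L (suc x)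
    step-dichotomy zero {x} {y} eq u∈ | yes p =
      ⊥-elim (<⇒≱ p (≤-trans (L-anti (s≤s z≤n) (s≤s z≤n)) (≤-reflexive (trans (sym eq) (+-identityʳ y)))))
    step-dichotomy (suc g) {x} {y} eq u∈ | yes p with step-dichotomy g (trans (sym (+-suc y g)) eq) (s≤s z≤n , s≤s z≤n , p)
    ... | inj₁ v = inj₁ (Vert-nw v)
    ... | inj₂ (j , h) = inj₂ (j , Horiz-nw h)
    step-dichotomy g {x} {y} eq u∈@(1≤x , 1≤y , y≤) | no ¬p with y ≤? L (suc x)
    ... | yes q = inj₁ (suc x , s≤s z≤n , cong (_+ suc x) (≤-antisym (≤-pred (≰⇒> ¬p)) q))
    ... | no ¬q = inj₂ (y , 1≤y , cong (y +_)
      (≤-antisym (L⇒M 1≤x 1≤y y≤) (≤-pred (≰⇒> (λ r → ¬q (M⇒L (s≤s z≤n) r))))))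

  vert-or-horiz : ∀ {u} → u ∈λ la → Vert u ⊎ ∃[ j ] Horiz u j
  vert-or-horiz {x , y} u∈@(1≤x , 1≤y , y≤) =
    step-dichotomy (L 1 ∸ y) (m+[n∸m]≡n (≤-trans y≤ (L-anti (s≤s z≤n) 1≤x))) u∈

  Vert-rowEnd : ∀ {x y} → (x , y) ∈λ la → ¬ ((x , suc y) ∈λ la) → Vert (x , suc y)
  Vert-rowEnd {x} {y} (1≤x , 1≤y , y≤) e∉ = x , 1≤x ,
    trans (+-suc (L x) x) (cong (λ z → suc (z + x)) (≤-antisym (≤-pred (≰⇒> (λ q → e∉ (1≤x , s≤s z≤n , q)))) y≤))

  -- At j f u: the diagonal of u lies f steps after the one where the hooks of column j start.
  At : ℕ → ℕ → Cell → Set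
  At j f (x , y) = j + x + f ≡ y + M j

  Horiz⇒At : ∀ {u j} → Horiz u j → At j 0 u
  Horiz⇒At (_ , eq) = trans (+-identityʳ _) eq

  At⇒Horiz : ∀ {u j} → 1 ≤ j → At j 0 u → Horiz u j
  At⇒Horiz 1≤j eq = 1≤j , trans (sym (+-identityʳ _)) eq

  At-south : ∀ {j f x y} → At j (suc f) (x , y) → At j f (suc x , y)
  At-south {j} {f} {x} eq = trans (trans (cong (_+ f) (+-suc j x)) (sym (+-suc (j + x) f))) eq

  At-north : ∀ {j f x y} → At j f (suc x , y) → At j (suc f) (x , y)
  At-north {j} {f} {x} eq = trans (+-suc (j + x) f) (trans (cong (_+ f) (sym (+-suc j x))) eq)

  At-west : ∀ {j f x y} → At j (suc f) (x , suc y) → At j f (x , y)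
  At-west {j} {f} {x} eq = suc-injective (trans (sym (+-suc (j + x) f)) eq)

  At-east : ∀ {j f x y} → At j f (x , y) → At j (suc f) (x , suc y)
  At-east {j} {f} {x} eq = trans (+-suc (j + x) f) (cong suc eq)

  At-unique : ∀ {j f f′ u} → At j f u → At j f′ u → f ≡ f′
  At-unique {j} {f} {f′} {x , y} p q = +-cancelˡ-≡ (j + x) f f′ (trans p (sym q))

  module _ where
    private
      col-mono : ∀ j m f x y x′ y′ → j + x + f ≡ y + m → j + x′ + f ≡ y′ + m → x ≤ x′ → y ≤ y′
      col-mono j m f x y x′ y′ p q r =
        lin-≤ y y′ (≤-reflexive (sym p) ⊕ ≤-reflexive q ⊕ r) 0 (solve (j ∷ m ∷ f ∷ x ∷ y ∷ x′ ∷ y′ ∷ []))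
      later : ∀ j m f x y k n → j + x + suc f ≡ y + m → k + x ≡ y + n → k ≤ j → m ≤ n → ⊥
      later j m f x y k n p q r s =
        lin-⊥ (≤-reflexive p ⊕ ≤-reflexive (sym q) ⊕ r ⊕ s) f (solve (j ∷ m ∷ f ∷ x ∷ y ∷ k ∷ n ∷ []))
      top : ∀ j m f i l x y → j + i + f ≡ l + m → j + x + f ≡ y + m → i < x → y ≤ l → ⊥
      top j m f i l x y p q r s =
        lin-⊥ (≤-reflexive (sym p) ⊕ ≤-reflexive q ⊕ r ⊕ s) 0 (solve (j ∷ m ∷ f ∷ i ∷ l ∷ x ∷ y ∷ []))
      shorter : ∀ j m f f′ i i′ l l′ → j + i + f ≡ l + m → j + i′ + f′ ≡ l′ + m → i < i′ → l′ ≤ l → f ≤ f′ → ⊥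
      shorter j m f f′ i i′ l l′ p q r s t =
        lin-⊥ (≤-reflexive (sym p) ⊕ ≤-reflexive q ⊕ r ⊕ s ⊕ t) 0 (solve (j ∷ m ∷ f ∷ f′ ∷ i ∷ i′ ∷ l ∷ l′ ∷ []))
      longer : ∀ j m f f′ i i′ l l′ → j + i + f ≡ l + m → j + i′ + f′ ≡ l′ + m → i′ ≤ i → l ≤ l′ → f ≤ f′
      longer j m f f′ i i′ l l′ p q r s =
        lin-≤ f f′ (≤-reflexive p ⊕ ≤-reflexive (sym q) ⊕ r ⊕ s) 0 (solve (j ∷ m ∷ f ∷ f′ ∷ i ∷ i′ ∷ l ∷ l′ ∷ []))

    At-col-mono : ∀ {j f x y x′ y′} → At j f (x , y) → At j f (x′ , y′) → x ≤ x′ → y ≤ y′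
    At-col-mono {j} {f} {x} {y} {x′} {y′} = col-mono j (M j) f x y x′ y′

    At-row-inj : ∀ {j f u v} → At j f u → At j f v → row u ≡ row v → u ≡ v
    At-row-inj {u = x , y} {x , y′} p q refl = cong (x ,_)
      (≤-antisym (At-col-mono p q ≤-refl) (At-col-mono q p ≤-refl))

    -- The contents `k - M k` of the horizontal steps increase with k, so a horizontal step beyond
    -- the start of column j belongs to a later column.
    Horiz-later : ∀ {j f u k} → 1 ≤ k → At j (suc f) u → Horiz u k → j < k
    Horiz-later {j} {f} {x , y} {k} 1≤k p (_ , q) with k ≤? j
    ... | yes k≤j = ⊥-elim (later j (M j) f x y k (M k) p q k≤j (M-anti 1≤k k≤j))
    ... | no  k≰j = ≰⇒> k≰j

    At-rowEnd-top : ∀ {j f i u} → 1 ≤ i → At j f (i , L i) → u ∈λ la → At j f u → row u ≤ i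
    At-rowEnd-top {j} {f} {i} {x , y} 1≤i p (_ , _ , y≤) q with x ≤? i
    ... | yes x≤i = x≤i
    ... | no  x≰i = ⊥-elim (top j (M j) f i (L i) x y p q (≰⇒> x≰i) (≤-trans y≤ (L-anti 1≤i (<⇒≤ (≰⇒> x≰i)))))

    At-rowEnd-anti : ∀ {j f f′ i i′} → 1 ≤ i → At j f (i , L i) → At j f′ (i′ , L i′) → f ≤ f′ → i′ ≤ i
    At-rowEnd-anti {j} {f} {f′} {i} {i′} 1≤i p q f≤ with i′ ≤? i
    ... | yes r = r
    ... | no  r = ⊥-elim (shorter j (M j) f f′ i i′ (L i) (L i′) p q (≰⇒> r) (L-anti 1≤i (<⇒≤ (≰⇒> r))) f≤)

    At-rowEnd-mono : ∀ {j f f′ i i′} → 1 ≤ i′ → At j f (i , L i) → At j f′ (i′ , L i′) → i′ ≤ i → f ≤ f′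
    At-rowEnd-mono {j} {f} {f′} {i} {i′} 1≤i′ p q r =
      longer j (M j) f f′ i i′ (L i) (L i′) p q r (L-anti 1≤i′ r)

  row≤M1 : ∀ {u} → u ∈λ la → row u ≤ M 1
  row≤M1 {x , y} (1≤x , 1≤y , y≤) = L⇒M 1≤x ≤-refl (≤-trans 1≤y y≤)

  record State (π : RPP) : Set where
    field
      -- Being zero outside the shape turns the convention for row and column 0 into actual values,
      -- and it lets two fillings be compared on all cells.
      off   : ∀ {u} → ¬ (u ∈λ la) → π u ≡ 0
      east  : ∀ {x y} → (x , suc y) ∈λ la → π (x , y) ≤ π (x , suc y)
      south : ∀ {x y} → (suc x , y) ∈λ la → π (x , y) ≤ π (suc x , y)

    north-≤ : ∀ {x y} → (x , y) ∈λ la → π (x ∸ 1 , y) ≤ π (x , y)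
    north-≤ {suc x} u∈ = south u∈

    west-≤ : ∀ {x y} → (x , y) ∈λ la → π (x , y ∸ 1) ≤ π (x , y)
    west-≤ {y = suc y} u∈ = east u∈

    northwest-≤ : ∀ {x y} → (x , y) ∈λ la → π (x ∸ 1 , y ∸ 1) ≤ π (x , y ∸ 1)
    northwest-≤ {x} {suc zero} u∈ =
      ≤-trans (≤-reflexive (off (λ { (_ , () , _) }))) z≤n
    northwest-≤ {x} {suc (suc y)} u∈ = north-≤ (west-∈ u∈ (s≤s z≤n))

  -- No rim-hook of a column ≥ j can be extracted from π.
  Trivial : RPP → ℕ → Set
  Trivial π j = ∀ {k x y} → j ≤ k → (x , suc y) ∈λ la → Horiz (x , suc y) k → π (x , suc y) ≡ π (x , y)

  -- Triviality of the single column j, restricted to the rows below a: an extraction from column j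
  -- must then start in row a or higher up.
  TrivialBelow : RPP → ℕ → ℕ → Set
  TrivialBelow π j a = ∀ {x y} → a < x → (x , suc y) ∈λ la → Horiz (x , suc y) j → π (x , suc y) ≡ π (x , y)

  -- The conditions for the two moves on a vertical diagonal are parameters, because the geometry of
  -- paths is the same for the forward and the reverse rule. A horizontal diagonal leaves no choice.
  data Move (S W : Cell → Set) : Cell → Cell → Set where
    south : ∀ {x y} → Vert (x , y) → S (x , y) → Move S W (x , y) (suc x , y)
    westV : ∀ {x y} → Vert (x , suc y) → W (x , suc y) → Move S W (x , suc y) (x , y)
    westH : ∀ {x y k} → Horiz (x , suc y) k → Move S W (x , suc y) (x , y)

  -- The rule of P(h, π), and the same rule as it can be read off π + P(h, π).
  Fwd Rev : RPP → Cell → Cell → Set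
  Fwd π = Move (λ u → π u ≡ π (sc u)) (λ u → π u < π (sc u))
  Rev π = Move (λ u → π u ≡ π (sc u)) (λ u → π (nc (wc u)) < π (wc u))

  Move-row : ∀ {S W u v} → Move S W u v → row u ≤ row v × row v ≤ suc (row u)
  Move-row (south _ _) = n≤1+n _ , ≤-refl
  Move-row (westV _ _) = ≤-refl , n≤1+n _
  Move-row (westH _)   = ≤-refl , n≤1+n _

  Move-at : ∀ {S W u v j f} → Move S W u v → At j (suc f) u → At j f v
  Move-at {f = f} (south {x} {y} _ _) p = At-south {f = f} {x} {y} p
  Move-at {f = f} (westV {x} {y} _ _) p = At-west {f = f} {x} {y} p
  Move-at {f = f} (westH {x} {y} _)   p = At-west {f = f} {x} {y} p

  Move-at⁻ : ∀ {S W u v j f} → Move S W u v → At j f v → At j (suc f) u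
  Move-at⁻ {f = f} (south {x} {y} _ _) p = At-north {f = f} {x} {y} p
  Move-at⁻ {f = f} (westV {x} {y} _ _) p = At-east {f = f} {x} {y} p
  Move-at⁻ {f = f} (westH {x} {y} _)   p = At-east {f = f} {x} {y} p

  rowEnd-∉ : ∀ {i} → ¬ ((i , suc (L i)) ∈λ la)
  rowEnd-∉ (_ , _ , p) = <-irrefl refl p

  Horiz-unique : ∀ {u j k} → Horiz u j → Horiz u k → ¬ (j < k)
  Horiz-unique {x , y} {j} {k} (1≤j , p) (_ , q) j<k =
    <⇒≱ (+-monoˡ-< x j<k) (≤-trans (≤-reflexive q) (≤-trans (+-monoʳ-≤ y (M-anti 1≤j (<⇒≤ j<k))) (≤-reflexive (sym p))))

  Horiz-south : ∀ {x y k} → Horiz (x , y) k → (suc x , y) ∈λ la → (suc x , suc y) ∈λ la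
  Horiz-south {x} {y} h s∈ with (suc x , suc y) ∈λ? la
  ... | yes p = p
  ... | no ¬p = ⊥-elim (Vert-¬Horiz (Vert-nw (Vert-rowEnd s∈ ¬p)) h)

  descend : (P : ℕ → Set) → ∀ n → P n → (∀ {f} → f < n → P (suc f) → P f) → ∀ {f} → f ≤ n → P f
  descend P zero    p s z≤n = p
  descend P (suc n) p s {f} f≤ with f ≟ suc n
  ... | yes refl = p
  ... | no  f≢   = descend P n (s ≤-refl p) (λ q → s (m≤n⇒m≤1+n q)) (≤-pred (≤∧≢⇒< f≤ f≢))

  -- The index is the distance from the first diagonal of column j, so the moves of the rule lower
  -- it. Two routes of the same column are on the same diagonal at equal indices even if their
  -- lengths differ.
  record Route (i j : ℕ) : Set where
    field
      len  : ℕ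
      cell : ℕ → Cell
      top  : cell len ≡ (i , L i)
      mem  : ∀ {f} → f ≤ len → cell f ∈λ la
      at   : ∀ {f} → f ≤ len → At j f (cell f)
      1≤j  : 1 ≤ j

    On : Cell → Set
    On v = ∃[ f ] (f ≤ len × v ≡ cell f)

    On? : ∀ v → Dec (On v)
    On? v = map′ (λ { (f , f< , eq) → f , ≤-pred f< , eq }) (λ { (f , f≤ , eq) → f , s≤s f≤ , eq })
      (anyUpTo? (λ f → v ≟c cell f) (suc len))

    1≤i : 1 ≤ i
    1≤i = proj₁ (subst (_∈λ la) top (mem ≤-refl))

    top-at : At j len (i , L i)
    top-at = subst (At j len) top (at ≤-refl)

    on-at : ∀ {v f} → On v → At j f v → v ≡ cell f
    on-at {v} {f} (f′ , f′≤ , refl) p = cong cell (At-unique {j} {u = v} (at f′≤) p)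

    on-len : ∀ {v f} → On v → At j f v → f ≤ len
    on-len {v} {f} (f′ , f′≤ , refl) p = subst (_≤ len) (At-unique {j} {u = v} (at f′≤) p) f′≤

    on-∈ : ∀ {v} → On v → v ∈λ la
    on-∈ (f , f≤ , refl) = mem f≤

  module _ {i j : ℕ} (R : Route i j) where
    open Route R

    Follows : (Cell → Cell → Set) → Set
    Follows Mv = ∀ {f} → f < len → Mv (cell (suc f)) (cell f)

    -- A relation and not an operation, so that it serves both insertion, where `π` is given, and
    -- removal, where `π′` is given.
    record Adds (π π′ : RPP) : Set where
      field
        on  : ∀ {v} → On v → π′ v ≡ suc (π v)
        out : ∀ {v} → ¬ On v → π′ v ≡ π v

      grows : ∀ v → π v ≤ π′ v
      grows v with On? v
      ... | yes o = ≤-trans (n≤1+n _) (≤-reflexive (sym (on o)))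
      ... | no ¬o = ≤-reflexive (sym (out ¬o))

      equal-up : ∀ {u v} → (On u → On v) → (On v → On u) → π u ≡ π v → π′ u ≡ π′ v
      equal-up {u} {v} to from eq with On? u
      ... | yes o = trans (on o) (trans (cong suc eq) (sym (on (to o))))
      ... | no ¬o = trans (out ¬o) (trans eq (sym (out (¬o ∘ from))))

      equal-down : ∀ {u v} → (On u → On v) → (On v → On u) → π′ u ≡ π′ v → π u ≡ π v
      equal-down {u} {v} to from eq with On? u
      ... | yes o = suc-injective (trans (sym (on o)) (trans eq (on (to o))))
      ... | no ¬o = trans (sym (out ¬o)) (trans eq (out (¬o ∘ from)))

      -- An inequality is endangered only if its smaller side grows alone, and strictness leaves
      -- room for that.
      up-≤ : ∀ {u v} → π u ≤ π v → (On u → On v ⊎ π u < π v) → π′ u ≤ π′ v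
      up-≤ {u} {v} le h with On? u
      ... | no ¬o = ≤-trans (≤-reflexive (out ¬o)) (≤-trans le (grows v))
      ... | yes o with h o
      ...   | inj₁ o′ = ≤-trans (≤-reflexive (on o)) (≤-trans (s≤s le) (≤-reflexive (sym (on o′))))
      ...   | inj₂ lt = ≤-trans (≤-reflexive (on o)) (≤-trans lt (grows v))

      down-≤ : ∀ {u v} → π′ u ≤ π′ v → (On v → On u ⊎ π′ u < π′ v) → π u ≤ π v
      down-≤ {u} {v} le h with On? v
      ... | no ¬o = ≤-trans (grows u) (≤-trans le (≤-reflexive (out ¬o)))
      ... | yes o with h o
      ...   | inj₁ o′ = ≤-pred (≤-trans (≤-reflexive (sym (on o′))) (≤-trans le (≤-reflexive (on o))))
      ...   | inj₂ lt = ≤-pred (≤-trans (s≤s (grows u)) (≤-trans lt (≤-reflexive (on o))))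

  -- The fields `start` and `stop` are the strict inequalities at the two ends of the reverse walk;
  -- `right` and `below` make its starting point extremal. Every condition is on `π` alone, with no
  -- reference to the filling before the insertion.
  record Extract (π : RPP) (i j : ℕ) : Set where
    field
      route   : Route i j
      follows : Follows route (Rev π)
      start   : π (wc (Route.cell route 0)) < π (Route.cell route 0)
      stop    : π (i ∸ 1 , L i) < π (i , L i)
      right   : Trivial π (suc j)
      below   : TrivialBelow π j (row (Route.cell route 0))

  -- Routes and their neighbouring cells

  module _ {i j : ℕ} (R : Route i j) where
    open Route R

    module _ {S W : Cell → Set} (moves : Follows R (Move S W)) where

      -- A route leaves a horizontal diagonal only westwards, so the two cells compared by `Trivial`
      -- are both on it or both off it. The exception is the first diagonal, that of column j
      -- itself.
      horiz-on-west : ∀ {x y k} → j < k → Horiz (x , suc y) k → On (x , suc y) → On (x , y)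
      horiz-on-west {x} {y} {k} j<k h (zero , _ , eq) =
        ⊥-elim (Horiz-unique (At⇒Horiz {x , suc y} 1≤j (subst (At j 0) (sym eq) (at z≤n))) h j<k)
      horiz-on-west {x} {y} {k} j<k h (suc f , f< , eq) = go eq refl (moves f<)
        where
        go : ∀ {u v} → (x , suc y) ≡ u → v ≡ cell f → Move S W u v → On (x , y)
        go refl _ (south v _) = ⊥-elim (Vert-¬Horiz v h)
        go refl e (westV _ _) = f , <⇒≤ f< , e
        go refl e (westH _)   = f , <⇒≤ f< , e

      horiz-on-east : ∀ {x y k} → (x , suc y) ∈λ la → Horiz (x , suc y) k → On (x , y) → On (x , suc y)
      horiz-on-east {x} {y} {k} u∈ h (f , f≤ , eq) with f ≟ len
      ... | yes refl = ⊥-elim (go (trans eq top))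
        where
        go : (x , y) ≡ (i , L i) → ⊥
        go refl = rowEnd-∉ u∈
      ... | no f≢ = go refl eq (moves f<)
        where
        f< = ≤∧≢⇒< f≤ f≢
        go : ∀ {u v} → u ≡ cell (suc f) → (x , y) ≡ v → Move S W u v → On (x , suc y)
        go _ refl (south v _) = ⊥-elim (Vert-¬Horiz (Vert-es v) h)
        go e refl (westV _ _) = suc f , f< , e
        go e refl (westH _)   = suc f , f< , e

    on-below : ∀ {x y} → row (cell 0) < x → Horiz (x , y) j → ¬ On (x , y)
    on-below {x} {y} lt h o = <-irrefl (sym (cong row (on-at o (Horiz⇒At {x , y} h)))) lt

    on-west-of-start : ∀ {x y} → At j 0 (x , suc y) → ¬ On (x , y)
    on-west-of-start {x} {y} p (f , f≤ , eq)
      with At-unique {j} {0} {suc f} {x , suc y} p (At-east {f = f} {x} {y} (subst (At j f) (sym eq) (at f≤)))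
    ... | ()

    on-other-row : ∀ {f u v} → f ≤ len → u ≡ cell f → At j f v → row u ≢ row v → ¬ On v
    on-other-row f≤ eq p r o = r (cong row (trans eq (sym (on-at o p))))

    start-west-out : ¬ On (wc (cell 0))
    start-west-out = go (cell 0) refl
      where
      go : ∀ u → u ≡ cell 0 → ¬ On (wc u)
      go (x , suc y) eq = on-west-of-start (subst (At j 0) (sym eq) (at z≤n))
      go (x , zero)  eq with subst (_∈λ la) (sym eq) (mem z≤n)
      ... | _ , () , _

    top-north-out : ¬ On (i ∸ 1 , L i)
    top-north-out = go i refl
      where
      go : ∀ i′ → i′ ≡ i → ¬ On (i′ ∸ 1 , L i)
      go zero     refl o with 1≤i
      ... | ()
      go (suc i′) refl o = 1+n≰n (on-len o (At-north {f = len} {i′} top-at))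

    module _ {π π′ : RPP} (A : Adds R π π′) where
      open Adds A

      trivial-up : ∀ {S W} → Follows R (Move S W) → Trivial π (suc j) → Trivial π′ (suc j)
      trivial-up mv t j<k u∈ h = equal-up (horiz-on-west mv j<k h) (horiz-on-east mv u∈ h) (t j<k u∈ h)

      trivial-down : ∀ {S W} → Follows R (Move S W) → Trivial π′ (suc j) → Trivial π (suc j)
      trivial-down mv t j<k u∈ h = equal-down (horiz-on-west mv j<k h) (horiz-on-east mv u∈ h) (t j<k u∈ h)

      below-up : TrivialBelow π j (row (cell 0)) → TrivialBelow π′ j (row (cell 0))
      below-up t {x} {y} a<x u∈ h = trans (out (on-below a<x h))
        (trans (t a<x u∈ h) (sym (out (on-west-of-start (Horiz⇒At {x , suc y} h)))))

      below-down : TrivialBelow π′ j (row (cell 0)) → TrivialBelow π j (row (cell 0))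
      below-down t {x} {y} a<x u∈ h = trans (sym (out (on-below a<x h)))
        (trans (t a<x u∈ h) (out (on-west-of-start (Horiz⇒At {x , suc y} h))))

      -- For a west move from u to v, the north neighbour of v lies on the diagonal of u but in
      -- another row. The route misses it, so its entry is kept while the entry of v grows. The
      -- converse uses the south neighbour of u, which lies on the diagonal of v.
      fwd⇒rev : State π → Follows R (Fwd π) → Follows R (Rev π′)
      fwd⇒rev st mv {f} f< = go refl refl (mv f<)
        where
        go : ∀ {u v} → u ≡ cell (suc f) → v ≡ cell f → Fwd π u v → Rev π′ u v
        go e e′ (south v eq) = south v (trans (on (suc f , f< , e)) (trans (cong suc eq) (sym (on (f , <⇒≤ f< , e′)))))
        go e e′ (westH h) = westH h
        go {u} e e′ (westV {x} {y} v _) = westV v (begin-strict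
          π′ (x ∸ 1 , y) ≡⟨ out (nout x refl) ⟩
          π (x ∸ 1 , y)  ≤⟨ State.north-≤ st v∈ ⟩
          π (x , y)      <⟨ n<1+n _ ⟩
          suc (π (x , y)) ≡⟨ sym (on (f , <⇒≤ f< , e′)) ⟩
          π′ (x , y) ∎)
          where
          open ≤-Reasoning
          v∈ : (x , y) ∈λ la
          v∈ = subst (_∈λ la) (sym e′) (mem (<⇒≤ f<))
          nout : ∀ x′ → x′ ≡ x → ¬ On (x′ ∸ 1 , y)
          nout zero     refl = ⊥-elim (<-irrefl refl (proj₁ v∈))
          nout (suc x′) refl = on-other-row f< e
            (At-north {f = f} {x′} (subst (At j f) (sym e′) (at (<⇒≤ f<)))) (λ ())

      rev⇒fwd : State π′ → Follows R (Rev π′) → Follows R (Fwd π)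
      rev⇒fwd st mv {f} f< = go refl refl (mv f<)
        where
        go : ∀ {u v} → u ≡ cell (suc f) → v ≡ cell f → Rev π′ u v → Fwd π u v
        go e e′ (south v eq) = south v (suc-injective (trans (sym (on (suc f , f< , e))) (trans eq (on (f , <⇒≤ f< , e′)))))
        go e e′ (westH h) = westH h
        go {u} e e′ (westV {x} {y} v _) = westV v (begin-strict
          π (x , suc y) <⟨ n<1+n _ ⟩
          suc (π (x , suc y)) ≡⟨ sym (on (suc f , f< , e)) ⟩
          π′ (x , suc y) ≤⟨ State.south st (Vert-south (subst (_∈λ la) (sym e) (mem f<)) v) ⟩
          π′ (suc x , suc y) ≡⟨ out (on-other-row (<⇒≤ f<) e′ (At-south {f = f} {x} {suc y} (subst (At j (suc f)) (sym e) (at f<))) (λ ())) ⟩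
          π (suc x , suc y) ∎)
          where open ≤-Reasoning

  -- Insertion and removal preserve monotonicity.

  Addable : RPP → Cell → Set
  Addable π u = ec (sc u) ∈λ la → π u < π (ec (sc u))

  Removable : RPP → Cell → Set
  Removable π u = π (nc (wc u)) < π u

  module _ {π : RPP} (st : State π) {j : ℕ} (right : Trivial π (suc j)) where
    private module St = State st

    -- Triviality of the later column identifies the entries at `sc u` and `ec (sc u)`, so the gap
    -- to the south-east is also a gap to the south.
    addable-horiz : ∀ {f u k} → At j (suc f) u → Horiz u k → Addable π u → sc u ∈λ la → π u < π (sc u)
    addable-horiz {u = x , y} p h@(1≤k , _) a s∈ =
      <-≤-trans (a es∈) (≤-reflexive (right (Horiz-later {u = x , y} 1≤k p h) es∈ (Horiz-es h)))
      where es∈ = Horiz-south h s∈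

    -- After a west move the south-east neighbour of v is the south neighbour of u, and the gap to
    -- it is what the rule tested or what `addable-horiz` gives. After a south move v has the entry
    -- of u, and the gap at u is passed on.
    addable-step : ∀ {f u v} → At j (suc f) u → u ∈λ la → Fwd π u v → Addable π u → Addable π v
    addable-step p u∈ (south v eq) a es∈ =
      <-≤-trans (≤-<-trans (≤-reflexive (sym eq)) (a (north-∈ es∈ (s≤s z≤n)))) (St.south es∈)
    addable-step p u∈ (westV v lt) a es∈ = ≤-<-trans (St.east u∈) lt
    addable-step {u = u} p u∈ (westH h) a es∈ = ≤-<-trans (St.east u∈) (addable-horiz {u = u} p h a es∈)

    removable-step : ∀ {f u v} → At j (suc f) u → u ∈λ la → v ∈λ la → Rev π u v → Removable π v → Removable π u
    removable-step p u∈ v∈ (south v eq) r = ≤-<-trans (St.northwest-≤ u∈) (<-≤-trans r (≤-reflexive (sym eq)))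
    removable-step p u∈ v∈ (westV v lt) r = <-≤-trans lt (St.east u∈)
    removable-step {f} p u∈ v∈ (westH {suc x} {y} {k} h) r = <-≤-trans lt (St.east u∈)
      where
      j<k = Horiz-later {f = f} {suc x , suc y} (proj₁ h) p h
      north : ∀ x y → (suc x , y) ∈λ la → Horiz (x , y) k → π (x , y) ≤ π (x , y ∸ 1)
      north zero y _ _ = ≤-trans (≤-reflexive (St.off (λ { (() , _) }))) z≤n
      north (suc x) (suc y) v∈ h = ≤-reflexive (right j<k (north-∈ v∈ (s≤s z≤n)) h)
      lt : π (x , y) < π (suc x , y)
      lt = ≤-<-trans (north x y v∈ (Horiz-nw h)) r

  module Insertion {π π′ : RPP} (st : State π) {i j : ℕ} (R : Route i j) (A : Adds R π π′)
    (moves : Follows R (Fwd π)) (right : Trivial π (suc j))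
    (below : TrivialBelow π j (row (Route.cell R 0))) where
    open Route R
    open Adds A
    private module St = State st

    addable : ∀ {f} → f ≤ len → Addable π (cell f)
    addable = descend (λ f → Addable π (cell f)) len
      -- A row end has no south-east neighbour, so a box can always be added there.
      (λ es∈ → ⊥-elim (top-∉ (subst (λ u → ec (sc u) ∈λ la) top es∈)))
      (λ f< → addable-step st right (at f<) (mem f<) (moves f<))
      where
      top-∉ : ¬ (ec (sc (i , L i)) ∈λ la)
      top-∉ es∈ = rowEnd-∉ (north-∈ es∈ 1≤i)

    increase-east : ∀ {v} → On v → ec v ∈λ la → On (ec v) ⊎ π v < π (ec v)
    increase-east {v} (f , f≤ , eq) e∈ with f ≟ len
    ... | yes refl = ⊥-elim (rowEnd-∉ (subst (λ u → ec u ∈λ la) (trans eq top) e∈))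
    ... | no f≢ = go refl (subst (Fwd π (cell (suc f))) (sym eq) (moves f<)) (addable f<)
      where
      f< = ≤∧≢⇒< f≤ f≢
      go : ∀ {u} → u ≡ cell (suc f) → Fwd π u v → Addable π u → On (ec v) ⊎ π v < π (ec v)
      go e (south _ q) a = inj₂ (≤-<-trans (≤-reflexive (sym q)) (a e∈))
      go e (westV _ _) a = inj₁ (suc f , f< , e)
      go e (westH _)   a = inj₁ (suc f , f< , e)

    increase-south : ∀ {v} → On v → sc v ∈λ la → On (sc v) ⊎ π v < π (sc v)
    -- At the west end no further move supplies the inequality. Triviality below the start does: it
    -- identifies the entries at `sc v` and `ec (sc v)`, and `Addable` gives the gap.
    increase-south {v} (zero , f≤ , eq) s∈ =
      inj₂ (<-≤-trans (subst (Addable π) (sym eq) (addable f≤) es∈)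
        (≤-reflexive (below (s≤s (≤-reflexive (sym (cong row eq)))) es∈ (Horiz-es h))))
      where
      h : Horiz v j
      h = At⇒Horiz {v} 1≤j (subst (At j 0) (sym eq) (at f≤))
      es∈ = Horiz-south h s∈
    increase-south {v} (suc f , f< , eq) s∈ =
      go refl (subst (λ u → Fwd π u (cell f)) (sym eq) (moves f<))
      where
      go : ∀ {w} → w ≡ cell f → Fwd π v w → On (sc v) ⊎ π v < π (sc v)
      go e (south _ _)  = inj₁ (f , <⇒≤ f< , e)
      go e (westV _ lt) = inj₂ lt
      go e (westH h)    = inj₂ (addable-horiz st right {u = v} (subst (At j (suc f)) (sym eq) (at f<)) h
                                 (subst (Addable π) (sym eq) (addable f<)) s∈)

    state : State π′
    state = record
      { off   = λ u∉ → trans (out (λ o → u∉ (on-∈ o))) (St.off u∉)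
      ; east  = λ e∈ → up-≤ (St.east e∈) (λ o → increase-east o e∈)
      ; south = λ s∈ → up-≤ (St.south s∈) (λ o → increase-south o s∈)
      }

    extract : Extract π′ i j
    extract = record
      { route   = R
      ; follows = fwd⇒rev R A st moves
      ; start   = begin-strict
          π′ (wc (cell 0)) ≡⟨ out (start-west-out R) ⟩
          π (wc (cell 0))  ≤⟨ St.west-≤ (mem z≤n) ⟩
          π (cell 0)       <⟨ n<1+n _ ⟩
          suc (π (cell 0)) ≡⟨ sym (on (0 , z≤n , refl)) ⟩
          π′ (cell 0)      ∎
      ; stop    = begin-strict
          π′ (i ∸ 1 , L i) ≡⟨ out (top-north-out R) ⟩
          π (i ∸ 1 , L i)  ≤⟨ St.north-≤ (subst (_∈λ la) top (mem ≤-refl)) ⟩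
          π (i , L i)       <⟨ n<1+n _ ⟩
          suc (π (i , L i)) ≡⟨ sym (on (len , ≤-refl , sym top)) ⟩
          π′ (i , L i)      ∎
      ; right   = trivial-up R A moves right
      ; below   = below-up R A below
      }
      where open ≤-Reasoning

  extract-removable : ∀ {π} → State π → ∀ {i j} (X : Extract π i j) → let open Route (Extract.route X) in
    ∀ {f} → f ≤ len → Removable π (cell f)
  extract-removable st X {zero}  f≤ = ≤-<-trans (State.northwest-≤ st (Route.mem (Extract.route X) f≤)) (Extract.start X)
  extract-removable st X {suc f} f< = removable-step st right (at f<) (mem f<) (mem (<⇒≤ f<)) (follows f<)
      (extract-removable st X (<⇒≤ f<))
    where
    open Extract X
    open Route route

  module Removal {π π′ : RPP} (st : State π′) {i j : ℕ} (X : Extract π′ i j)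
    (A : Adds (Extract.route X) π π′) where
    open Extract X renaming (route to R)
    open Route R
    open Adds A
    private module St = State st

    decrease-east : ∀ {x y} → (x , suc y) ∈λ la → On (x , suc y) → On (x , y) ⊎ π′ (x , y) < π′ (x , suc y)
    decrease-east {x} {y} u∈ (zero , f≤ , eq) = inj₂ (subst (λ u → π′ (wc u) < π′ u) (sym eq) start)
    decrease-east {x} {y} u∈ (suc f , f< , eq) = go refl (subst (λ u → Rev π′ u (cell f)) (sym eq) (follows f<)) (extract-removable st X (<⇒≤ f<))
      where
      go : ∀ {w} → w ≡ cell f → Rev π′ (x , suc y) w → Removable π′ (cell f) → On (x , y) ⊎ π′ (x , y) < π′ (x , suc y)
      go e (south _ q) r = inj₂ (<-≤-trans (subst (Removable π′) (sym e) r) (≤-reflexive (sym q)))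
      go e (westV _ _) r = inj₁ (f , <⇒≤ f< , e)
      go e (westH _)   r = inj₁ (f , <⇒≤ f< , e)

    decrease-south : ∀ {x y} → (suc x , y) ∈λ la → On (suc x , y) → On (x , y) ⊎ π′ (x , y) < π′ (suc x , y)
    decrease-south {x} {y} u∈ (f , f≤ , eq) with f ≟ len
    ... | yes refl = inj₂ (go (trans eq top) stop)
      where
      go : ∀ {i l} → (suc x , y) ≡ (i , l) → π′ (i ∸ 1 , l) < π′ (i , l) → π′ (x , y) < π′ (suc x , y)
      go refl lt = lt
    ... | no f≢ = go refl (subst (Rev π′ (cell (suc f))) (sym eq) (follows f<)) (extract-removable st X f<)
      where
      f< = ≤∧≢⇒< f≤ f≢
      go : ∀ {u} → u ≡ cell (suc f) → Rev π′ u (suc x , y) → Removable π′ u → On (x , y) ⊎ π′ (x , y) < π′ (suc x , y)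
      go e (south _ _)  r = inj₁ (suc f , f< , e)
      go e (westV _ lt) r = inj₂ lt
      go e (westH h)    r = inj₂ (<-≤-trans r (≤-reflexive
        (right (Horiz-later {f = f} {suc x , suc y} (proj₁ h) (subst (At j (suc f)) (sym e) (at f<)) h)
               (subst (_∈λ la) (sym e) (mem f<)) h)))

    state : State π
    state = record
      { off   = λ u∉ → trans (sym (out (λ o → u∉ (on-∈ o)))) (St.off u∉)
      ; east  = λ e∈ → down-≤ (St.east e∈) (decrease-east e∈)
      ; south = λ s∈ → down-≤ (St.south s∈) (decrease-south s∈)
      }

    moves : Follows R (Fwd π)
    moves = rev⇒fwd R A st follows

  -- Comparing the routes of two extractions from the same column

  module _ {π ρ : RPP} {i i′ j : ℕ} (X : Extract π i j) (Y : Extract ρ i′ j) where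
    private
      module X = Extract X
      module Y = Extract Y
      module P = Route X.route
      module Q = Route Y.route

    module _ (start≤ : row (Q.cell 0) ≤ row (P.cell 0))
             (equal : ∀ {u v} → P.On u → P.On v → π u ≡ π v → ρ u ≡ ρ v) where

      -- Rows change by at most one per diagonal, so the routes could cross only through a common
      -- cell. If the first route continues north from it, two of its entries are equal in `π`;
      -- `equal` carries this over to `ρ`, where it forces the second route north as well.
      route-rows : ∀ {f} → f ≤ P.len → f ≤ Q.len → row (Q.cell f) ≤ row (P.cell f)
      route-rows {zero}  _  _  = start≤
      route-rows {suc f} p< q< with row (Q.cell f) ≟ row (P.cell f)
      ... | no ≢ = ≤-trans (proj₁ (Move-row (Y.follows q<)))
        (≤-pred (≤-trans (≤∧≢⇒< (route-rows (<⇒≤ p<) (<⇒≤ q<)) ≢) (proj₂ (Move-row (X.follows p<)))))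
      ... | yes eq = go refl refl (X.follows p<)
        (subst (Rev ρ (Q.cell (suc f))) (At-row-inj {j} {f} (Q.at (<⇒≤ q<)) (P.at (<⇒≤ p<)) eq) (Y.follows q<))
        where
        go : ∀ {u v w} → u ≡ P.cell (suc f) → v ≡ P.cell f → Rev π u v → Rev ρ w v → row w ≤ row u
        go _ _  (westV _ _)  m            = proj₁ (Move-row m)
        go _ _  (westH _)    m            = proj₁ (Move-row m)
        go _ _  (south _ _)  (south _ _)  = ≤-refl
        go e e′ (south _ eq) (westV _ lt) =
          ⊥-elim (<-irrefl (equal (suc f , p< , e) (f , <⇒≤ p< , e′) eq) lt)
        go _ _  (south v _)  (westH h)    = ⊥-elim (Vert-¬Horiz (Vert-es v) h)

      -- Suppose the second route ended earlier. Its end is the lowest cell of its diagonal and the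
      -- first route is not above it, so the first route passes through it. Continuing north
      -- contradicts `Y.stop`, continuing east leaves the shape.
      route-len : P.len ≤ Q.len
      route-len with P.len ≤? Q.len
      ... | yes p = p
      ... | no ¬p = ⊥-elim (go refl refl (subst (Rev π (P.cell (suc f))) (sym ω≡) (X.follows q<)))
        where
        q< = ≰⇒> ¬p
        f = Q.len
        ω≡ : (i′ , L i′) ≡ P.cell f
        ω≡ = At-row-inj {j} {f} Q.top-at (P.at (<⇒≤ q<)) (≤-antisym
          (subst (λ u → row u ≤ row (P.cell f)) Q.top (route-rows (<⇒≤ q<) ≤-refl))
          (At-rowEnd-top {j} {f} Q.1≤i Q.top-at (P.mem (<⇒≤ q<)) (P.at (<⇒≤ q<))))
        go : ∀ {u v} → u ≡ P.cell (suc f) → v ≡ (i′ , L i′) → Rev π u v → ⊥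
        go e refl (south _ eq) = <-irrefl (equal (suc f , q< , e) (f , <⇒≤ q< , ω≡) eq) Y.stop
        go e refl (westV _ _)  = rowEnd-∉ (subst (_∈λ la) (sym e) (P.mem q<))
        go e refl (westH _)    = rowEnd-∉ (subst (_∈λ la) (sym e) (P.mem q<))

  module _ {π : RPP} {i j : ℕ} (X : Extract π i j) where
    open Extract X
    open Route route

    private
      start-col : ∀ u → cell 0 ≡ u → ∃[ y ] (u ≡ (row u , suc y))
      start-col (x , zero)  eq with subst (_∈λ la) eq (mem z≤n)
      ... | _ , () , _
      start-col (x , suc y) eq = y , refl

    extract-column≤ : ∀ {k} → Trivial π (suc k) → j ≤ k
    extract-column≤ {k} t with j ≤? k
    ... | yes p = p
    ... | no ¬p with start-col (cell 0) refl
    ...   | y , eq = ⊥-elim (<-irrefl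
      (sym (t (≰⇒> ¬p) (subst (_∈λ la) eq (mem z≤n)) (At⇒Horiz {row (cell 0) , suc y} 1≤j (subst (At j 0) eq (at z≤n)))))
      (subst (λ u → π (wc u) < π u) eq start))

    extract-row≤ : ∀ {a} → TrivialBelow π j a → row (cell 0) ≤ a
    extract-row≤ {a} t with row (cell 0) ≤? a
    ... | yes p = p
    ... | no ¬p with start-col (cell 0) refl
    ...   | y , eq = ⊥-elim (<-irrefl
      (sym (t (≰⇒> ¬p) (subst (_∈λ la) eq (mem z≤n)) (At⇒Horiz {row (cell 0) , suc y} 1≤j (subst (At j 0) eq (at z≤n)))))
      (subst (λ u → π (wc u) < π u) eq start))

  -- Removal of a route preserves triviality to the right of its column and below its start, so the
  -- next extraction has no later column and, within the same column, no lower start. Not crossing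
  -- makes it at least as long, hence its row end is at least as high.
  extract-order : ∀ {π π⁻ i j i′ j′} (X : Extract π i j) → Adds (Extract.route X) π⁻ π →
    Extract π⁻ i′ j′ → (i , j) ≤rl (i′ , j′)
  extract-order {j = j} {j′ = j′} X A Y with j′ ≟ j
  ... | no ≢ = inj₁ (≤∧≢⇒< (extract-column≤ Y (trivial-down (Extract.route X) A (Extract.follows X) (Extract.right X))) ≢)
  ... | yes refl = inj₂ (refl , At-rowEnd-anti {j} P.1≤i P.top-at (Route.top-at (Extract.route Y))
      (route-len X Y (extract-row≤ Y (below-down (Extract.route X) A (Extract.below X)))
        (λ o o′ → Adds.equal-down A (λ _ → o′) (λ _ → o))))
    where module P = Route (Extract.route X)

  -- The column and the starting row are the extremal nontrivial ones, so they are determined by the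
  -- filling. Comparing the routes in both directions then gives equal lengths and equal cells.
  extract-unique : ∀ {π ρ i j i′ j′} (X : Extract π i j) (Y : Extract ρ i′ j′) → (∀ u → π u ≡ ρ u) →
    (i , j) ≡ (i′ , j′) × (∀ {u} → Route.On (Extract.route X) u → Route.On (Extract.route Y) u)
  extract-unique {π} {ρ} {i} {j} {i′} {j′} X Y π≗ρ
    with ≤-antisym (extract-column≤ X {j′} (λ p u∈ h → trans (π≗ρ _) (trans (Extract.right Y p u∈ h) (sym (π≗ρ _)))))
                   (extract-column≤ Y {j} (λ p u∈ h → trans (sym (π≗ρ _)) (trans (Extract.right X p u∈ h) (π≗ρ _))))
  ... | refl = cong (_, j) (≤-antisym (At-rowEnd-anti {j} Q.1≤i Q.top-at P.top-at (≤-reflexive (sym len≡)))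
                                      (At-rowEnd-anti {j} P.1≤i P.top-at Q.top-at (≤-reflexive len≡))) , on
    where
    module P = Route (Extract.route X)
    module Q = Route (Extract.route Y)
    a≤ : row (P.cell 0) ≤ row (Q.cell 0)
    a≤ = extract-row≤ X (λ p u∈ h → trans (π≗ρ _) (trans (Extract.below Y p u∈ h) (sym (π≗ρ _))))
    a≥ : row (Q.cell 0) ≤ row (P.cell 0)
    a≥ = extract-row≤ Y (λ p u∈ h → trans (sym (π≗ρ _)) (trans (Extract.below X p u∈ h) (π≗ρ _)))
    to : ∀ {u v} → π u ≡ π v → ρ u ≡ ρ v
    to eq = trans (sym (π≗ρ _)) (trans eq (π≗ρ _))
    from : ∀ {u v} → ρ u ≡ ρ v → π u ≡ π v
    from eq = trans (π≗ρ _) (trans eq (sym (π≗ρ _)))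
    len≡ : P.len ≡ Q.len
    len≡ = ≤-antisym (route-len X Y a≥ (λ _ _ → to)) (route-len Y X a≤ (λ _ _ → from))
    on : ∀ {u} → P.On u → Q.On u
    on (f , f≤ , refl) = f , f≤′ , At-row-inj {j} {f} (P.at f≤) (Q.at f≤′)
        (≤-antisym (route-rows Y X a≤ (λ _ _ → from) f≤′ f≤) (route-rows X Y a≥ (λ _ _ → to) f≤ f≤′))
      where f≤′ = ≤-trans f≤ (≤-reflexive len≡)

  -- Forward routes stay inside the shape.

  module _ where
    private
      before : ∀ j x m y k n → j + x ≤ suc m → k + x ≡ suc y + n → m ≤ n → k < j → ⊥
      before j x m y k n p q r s =
        lin-⊥ (p ⊕ ≤-reflexive (sym q) ⊕ r ⊕ s) y (solve (j ∷ x ∷ m ∷ y ∷ k ∷ n ∷ []))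
      exact : ∀ j x y m → j + x ≡ suc m → (j + y) + x ≡ suc y + m
      exact j x y m eq = trans (trans (+-assoc j y x) (trans (cong (j +_) (+-comm y x)) (sym (+-assoc j x y))))
        (trans (cong (_+ y) eq) (cong suc (+-comm m y)))

    -- If nothing can be extracted from columns ≥ j, then each of the partitions read
    -- along the diagonals from column j on has at most j ∸ 1 nonzero parts.
    vanish : ∀ {π} → State π → ∀ {j} → 1 ≤ j → Trivial π j → ∀ {x y} → (x , suc y) ∈λ la →
      j + x ≤ suc (M (j + y)) → π (x , suc y) ≡ 0
    vanish {π} st {j} 1≤j t {x} {y} u∈ p = go (M 1 + suc y ∸ x) (m+[n∸m]≡n (≤-trans (row≤M1 u∈) (m≤m+n _ _))) u∈ p
      where
      -- The bound on x says that (x + j - 1 , y + j) lies in the shape: at least j - 1 cells follow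
      -- (x , suc y) on its diagonal, so its entry is the j-th part or a later one. The measure g
      -- drops with every step south or west.
      go : ∀ g {x y} → x + g ≡ M 1 + suc y → (x , suc y) ∈λ la → j + x ≤ suc (M (j + y)) → π (x , suc y) ≡ 0
      go zero {x} {y} eq u∈ p = ⊥-elim (<⇒≱ (s≤s (row≤M1 u∈))
        (≤-trans (≤-trans (m≤m+n (suc (M 1)) y) (≤-reflexive (sym (+-suc (M 1) y)))) (≤-reflexive (trans (sym eq) (+-identityʳ x)))))
      go (suc g) {x} {y} eq u∈ p with vert-or-horiz u∈
      ... | inj₂ (k , h@(1≤k , q)) = trans (t j≤k u∈ h) (west y u∈ p eq)
        where
        j≤k : j ≤ k
        j≤k with j ≤? k
        ... | yes r = r
        ... | no  r = ⊥-elim (before j x (M (j + y)) y k (M k) p q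
          (M-anti 1≤k (≤-trans (<⇒≤ (≰⇒> r)) (m≤m+n j y))) (≰⇒> r))
        west : ∀ y → (x , suc y) ∈λ la → j + x ≤ suc (M (j + y)) → x + suc g ≡ M 1 + suc y → π (x , y) ≡ 0
        west zero    _  _ _  = State.off st (λ { (_ , () , _) })
        west (suc y) u∈ p eq = go g (suc-injective (trans (sym (+-suc x g)) (trans eq (+-suc (M 1) (suc y)))))
          (west-∈ u∈ (s≤s z≤n))
          (≤-trans p (s≤s (M-anti (≤-trans 1≤j (m≤m+n j y)) (+-monoʳ-≤ j (n≤1+n y)))))
      ... | inj₁ v = n≤0⇒n≡0 (≤-trans (State.south st s∈) (≤-reflexive (go g (trans (sym (+-suc x g)) eq) s∈ p′)))
        where
        s∈ = Vert-south u∈ v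
        p′ : j + suc x ≤ suc (M (j + y))
        p′ with j + x ≟ suc (M (j + y))
        ... | yes r = ⊥-elim (Vert-¬Horiz {x , suc y} {j + y} v (≤-trans 1≤j (m≤m+n j y) , exact j x y (M (j + y)) r))
        ... | no  r = ≤-trans (≤-reflexive (+-suc j x)) (≤∧≢⇒< p r)

  -- A barrier keeps the forward route from leaving λ on the west side.
  record Barrier (π : RPP) (i j len : ℕ) : Set₁ where
    field
      Bar       : ℕ → Cell → Set
      bar-top   : Bar len (i , L i)
      bar-step  : ∀ {f u v} → f < len → u ∈λ la → At j (suc f) u → Bar (suc f) u → Fwd π u v → Bar f v
      bar-col   : ∀ {f x y} → f ≤ len → At j f (x , y) → Bar f (x , y) → 1 ≤ y
      bar-start : ∀ {u} → Bar 0 u → TrivialBelow π j (row u)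

  module _ where
    private
      sep : ∀ k x y n m j → k + x ≡ suc y + n → n ≤ m → m < j + x → j + suc y ≤ k → ⊥
      sep k x y n m j p q r s =
        lin-⊥ (≤-reflexive p ⊕ q ⊕ r ⊕ s) 0 (solve (k ∷ x ∷ y ∷ n ∷ m ∷ j ∷ []))
      next-bar : ∀ k x y n m j → k + x ≡ suc y + n → m ≤ n → k ≤ j + y → m < j + x
      next-bar k x y n m j p q r =
        lin-≤ (suc m) (j + x) (≤-reflexive (sym p) ⊕ q ⊕ r) 0 (solve (k ∷ x ∷ y ∷ n ∷ m ∷ j ∷ []))

    -- The barrier says that (x + j , y + j) is outside the shape: u is among the last j cells of
    -- its diagonal, those not covered by `vanish`. A west move on a vertical diagonal that left
    -- this zone would need a positive entry where `vanish` gives 0; on a horizontal diagonal the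
    -- position of the step excludes it.
    trivial-barrier : ∀ {π i j len} → State π → 1 ≤ i → 1 ≤ j → Trivial π j → Barrier π i j len
    trivial-barrier {π} {i} {j} {len} st 1≤i 1≤j t = record
      { Bar       = λ { _ (x , y) → M (j + y) < j + x }
      ; bar-top   = ≤-trans (≰⇒> (λ p → <⇒≱ (+-monoˡ-< (L i) 1≤j) (M⇒L 1≤i p))) (m≤n+m i j)
      ; bar-step  = λ _ _ → advance
      ; bar-col   = col
      ; bar-start = λ _ _ → t ≤-refl
      }
      where
      advance : ∀ {f u v} → At j (suc f) u → M (j + proj₂ u) < j + proj₁ u → Fwd π u v → M (j + proj₂ v) < j + proj₁ v
      advance p b (south {x} _ _) = ≤-trans b (+-monoʳ-≤ j (n≤1+n x))
      advance {f} {u} p b (westV {x} {y} v lt) with M (j + y) <? j + x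
      ... | yes q = q
      ... | no ¬q with (suc x , suc y) ∈λ? la
      ...   | no  s∉ = ⊥-elim (n≮0 (≤-trans lt (≤-reflexive (State.off st s∉))))
      ...   | yes s∈ = ⊥-elim (n≮0 (≤-trans lt (≤-reflexive (vanish st 1≤j t s∈
              (≤-trans (≤-reflexive (+-suc j x)) (s≤s (≮⇒≥ ¬q)))))))
      advance {f} {u} p b (westH {x} {y} {k} (1≤k , q)) with k ≤? j + y
      ... | yes r = next-bar k x y (M k) (M (j + y)) j q (M-anti 1≤k r) r
      ... | no  r = ⊥-elim (sep k x y (M k) (M (j + suc y)) j q
          (M-anti (≤-trans 1≤j (m≤m+n j (suc y))) r′) b r′)
        where r′ = ≤-trans (≤-reflexive (+-suc j y)) (≰⇒> r)
      col : ∀ {f x y} → f ≤ len → At j f (x , y) → M (j + y) < j + x → 1 ≤ y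
      col {f} {x} {zero} _ p b = ⊥-elim (<⇒≱ b (≤-trans (m≤m+n (j + x) f)
        (≤-reflexive (trans p (cong M (sym (+-identityʳ j)))))))
      col {y = suc y} _ _ _ = s≤s z≤n

    -- The barrier is the route of the previous hook of the same column. If the new route is in a
    -- common cell and the old one went south, the two entries are equal, so the forward rule goes
    -- south too. The new start is therefore no higher than the old one and inherits `below`.
    extract-barrier : ∀ {π i i′ j len} → (i , j) ∈λ la → At j len (i , L i) → Extract π i′ j → i′ ≤ i → Barrier π i j len
    extract-barrier {π} {i} {i′} {j} {len} u∈@(1≤i , 1≤j , j≤) p X i′≤i = record
      { Bar       = λ f u → row (cell f) ≤ row u
      ; bar-top   = At-rowEnd-top {j} {len} 1≤i p (mem len≤) (at len≤)
      ; bar-step  = advance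
      ; bar-col   = λ {f} f≤ q b → ≤-trans (proj₁ (proj₂ (mem (≤-trans f≤ len≤)))) (At-col-mono {j} {f} (at (≤-trans f≤ len≤)) q b)
      ; bar-start = λ b lt → below (≤-<-trans b lt)
      }
      where
      open Extract X
      open Route route hiding (1≤i; 1≤j) renaming (len to len′)
      len≤ : len ≤ len′
      len≤ = At-rowEnd-mono {j} (Route.1≤i route) p top-at i′≤i
      advance : ∀ {f u v} → f < len → u ∈λ la → At j (suc f) u → row (cell (suc f)) ≤ row u → Fwd π u v →
        row (cell f) ≤ row v
      advance {f} {u} f< u∈ q b m with row (cell (suc f)) ≟ row u
      ... | no ≢ = ≤-trans (proj₂ (Move-row (follows (≤-trans f< len≤)))) (≤-trans (≤∧≢⇒< b ≢) (proj₁ (Move-row m)))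
      ... | yes eq = go m (subst (λ w → Rev π w (cell f)) (At-row-inj {j} {suc f} (at (≤-trans f< len≤)) q eq) (follows (≤-trans f< len≤)))
        where
        go : ∀ {u v w} → Fwd π u v → Rev π u w → row w ≤ row v
        go m            (westV _ _)  = proj₁ (Move-row m)
        go m            (westH _)    = proj₁ (Move-row m)
        go (south _ _)  (south _ _)  = ≤-refl
        go (westV _ lt) (south _ eq) = ⊥-elim (<-irrefl eq lt)
        go (westH h)    (south v _)  = ⊥-elim (Vert-¬Horiz v h)

  module _ {π : RPP} {i j len : ℕ} (u∈ : (i , j) ∈λ la) (len-at : At j len (i , L i))
    (B : Barrier π i j len)
    (next : Cell → Cell) (next-fwd : ∀ {u} → u ∈λ la → Fwd π u (next u)) where
    open Barrier B

    private
      cell : ℕ → Cell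
      -- Indices count from the west end but the rule runs from the row end, so index f is reached
      -- after `len ∸ f` moves.
      cell f = fold (i , L i) next (len ∸ f)

      cell-next : ∀ {f} → f < len → cell f ≡ next (cell (suc f))
      cell-next {f} f< = cong (fold (i , L i) next) (+-∸-assoc 1 f<)

      cell-top : cell len ≡ (i , L i)
      cell-top = cong (fold (i , L i) next) (n∸n≡0 len)

      Good : ℕ → Cell → Set
      Good f u = u ∈λ la × At j f u × Bar f u

      advance : ∀ {f} → f < len → ∀ {u v} → Fwd π u v → Good (suc f) u → Good f v
      advance f< m (u∈ , p , b) = ∈ m (Move-at m p) (bar-step f< u∈ p b m) u∈ , Move-at m p , bar-step f< u∈ p b m
        where
        ∈ : ∀ {u v} → Fwd π u v → At j _ v → Bar _ v → u ∈λ la → v ∈λ la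
        ∈ (south v _) p b u∈ = Vert-south u∈ v
        ∈ (westV _ _) p b u∈ = west-∈ u∈ (bar-col (<⇒≤ f<) p b)
        ∈ (westH _)   p b u∈ = west-∈ u∈ (bar-col (<⇒≤ f<) p b)

      good : ∀ {f} → f ≤ len → Good f (cell f)
      good = descend (λ f → Good f (cell f)) len
        (subst (Good len) (sym cell-top)
          ((proj₁ u∈ , ≤-trans (proj₁ (proj₂ u∈)) (proj₂ (proj₂ u∈)) , ≤-refl) , len-at , bar-top))
        (λ {f} f< g → subst (Good f) (sym (cell-next f<)) (advance f< (next-fwd (proj₁ g)) g))

    forward-route : Route i j
    forward-route = record
      { len = len ; cell = cell ; top = cell-top
      ; mem = λ f≤ → proj₁ (good f≤) ; at = λ f≤ → proj₁ (proj₂ (good f≤)) ; 1≤j = proj₁ (proj₂ u∈) }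

    forward-follows : Follows forward-route (Fwd π)
    forward-follows f< = subst (Fwd π _) (sym (cell-next f<)) (next-fwd (proj₁ (good f<)))

    forward-below : TrivialBelow π j (row (cell 0))
    forward-below = bar-start (proj₂ (proj₂ (good z≤n)))

  -- Finding the extraction

  -- If (i , j) were outside the shape, the end of row i would lie on an earlier diagonal than the
  -- start of column j.
  route-∈ : ∀ {i j} → Route i j → (i , j) ∈λ la
  route-∈ {i} {j} R = 1≤i , 1≤j , go
    where
    open Route R
    too-far : ∀ j i f l m → j + i + f ≡ l + m → l < j → m < i → ⊥
    too-far j i f l m p q r = lin-⊥ (≤-reflexive p ⊕ q ⊕ r) (suc f) (solve (j ∷ i ∷ f ∷ l ∷ m ∷ []))
    go : j ≤ L i
    go with j ≤? L i
    ... | yes p = p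
    ... | no ¬p = ⊥-elim (too-far j i len (L i) (M j) top-at (≰⇒> ¬p) (≰⇒> (λ q → ¬p (M⇒L 1≤i q))))

  module _ {π : RPP} (st : State π) where
    private module St = State st

    record Climb (u : Cell) : Set where
      field
        i len   : ℕ
        cell    : ℕ → Cell
        bottom  : cell 0 ≡ u
        top     : cell len ≡ (i , L i)
        stop    : π (i ∸ 1 , L i) < π (i , L i)
        mem     : ∀ {f} → f ≤ len → cell f ∈λ la
        follows : ∀ {f} → f < len → Rev π (cell (suc f)) (cell f)

    climb-cons : ∀ {u v} → v ∈λ la → Rev π u v → Climb u → Climb v
    climb-cons {u} {v} v∈ m C = record
      { i = i ; len = suc len ; cell = λ { zero → v ; (suc f) → cell f }
      ; bottom = refl ; top = top ; stop = stop
      ; mem = λ { {zero} _ → v∈ ; {suc f} (s≤s p) → mem p }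
      ; follows = λ { {zero} _ → subst (λ w → Rev π w v) (sym bottom) m ; {suc f} (s≤s p) → follows p } }
      where open Climb C

    module _ {j : ℕ} (right : Trivial π (suc j)) where

      -- Every reverse step raises the content by one, and g is its distance from `L 1`. `Removable`
      -- makes the entry positive, so it cannot equal an entry outside the shape, and the walk never
      -- goes north out of it.
      climb : ∀ g {f x y} → y + g ≡ x + L 1 → (x , y) ∈λ la → At j f (x , y) → Removable π (x , y) → Climb (x , y)
      climb zero {f} {x} {y} eq (1≤x , _ , y≤) p r =
        ⊥-elim (<⇒≱ (≤-trans (+-monoˡ-< (L 1) 1≤x) (≤-reflexive (trans (sym eq) (+-identityʳ y)))) (≤-trans y≤ (L-anti ≤-refl 1≤x)))
      climb (suc g) {f} {suc x} {y} eq u∈ p r = go ((suc x , suc y) ∈λ? la)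
        where
        east : (suc x , suc y) ∈λ la → Rev π (suc x , suc y) (suc x , y) → Climb (suc x , y)
        east e∈ m = climb-cons u∈ m (climb g (trans (sym (+-suc y g)) eq) e∈ p′ (removable-step st right {f} p′ e∈ u∈ m r))
          where p′ = At-east {f = f} {suc x} {y} p
        north : Vert (x , y) → π (x , y) ≡ π (suc x , y) → Climb (suc x , y)
        north v e with (x , y) ∈λ? la
        ... | no ∉ = ⊥-elim (n≮0 (<-≤-trans r (≤-reflexive (trans (sym e) (St.off ∉)))))
        ... | yes n∈ = climb-cons u∈ m (climb g (suc-injective (trans (sym (+-suc y g)) eq)) n∈ p′
                                          (removable-step st right {f} p′ n∈ u∈ m r))
          where
          m = south v e
          p′ = At-north {f = f} {x} p
        vert : Vert (suc x , suc y) → (π (x , y) < π (suc x , y) → Climb (suc x , y)) → Climb (suc x , y)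
        vert v otherwise with π (x , y) ≟ π (suc x , y)
        ... | yes e = north (Vert-nw v) e
        ... | no ≢  = otherwise (≤∧≢⇒< (St.south u∈) ≢)
        go : Dec ((suc x , suc y) ∈λ la) → Climb (suc x , y)
        go (yes e∈) with vert-or-horiz e∈
        ... | inj₁ v       = vert v (λ lt → east e∈ (westV v lt))
        ... | inj₂ (k , h) = east e∈ (westH h)
        go (no e∉) = vert (Vert-rowEnd u∈ e∉) (λ lt → record
          { i = suc x ; len = 0 ; cell = λ _ → suc x , y ; bottom = refl ; top = cong (suc x ,_) y≡
          ; stop = subst (λ z → π (x , z) < π (suc x , z)) y≡ lt
          ; mem = λ _ → u∈ ; follows = λ () })
          where
          y≡ : y ≡ L (suc x)
          y≡ = ≤-antisym (proj₂ (proj₂ u∈)) (≤-pred (≰⇒> (λ q → e∉ (s≤s z≤n , s≤s z≤n , q))))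

      extract-from : ∀ {x y} → 1 ≤ j → (x , suc y) ∈λ la → Horiz (x , suc y) j → π (x , y) < π (x , suc y) →
        TrivialBelow π j x → ∃[ i ] Extract π i j
      extract-from {x} {y} 1≤j u∈ h lt below = C.i , record
        { route = record { len = C.len ; cell = C.cell ; top = C.top ; mem = C.mem ; at = at ; 1≤j = 1≤j }
        ; follows = C.follows
        ; start = subst (λ u → π (wc u) < π u) (sym C.bottom) lt
        ; stop = C.stop
        ; right = right
        ; below = subst (λ u → TrivialBelow π j (row u)) (sym C.bottom) below }
        where
        C : Climb (x , suc y)
        C = climb (x + L 1 ∸ suc y) (m+[n∸m]≡n (≤-trans (proj₂ (proj₂ u∈)) (≤-trans (L-anti ≤-refl (proj₁ u∈)) (m≤n+m (L 1) x))))
          u∈ (Horiz⇒At {x , suc y} h) (≤-<-trans (St.northwest-≤ u∈) lt)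
        module C = Climb C
        at : ∀ {f} → f ≤ C.len → At j f (C.cell f)
        at {zero}  _  = subst (At j 0) (sym C.bottom) (Horiz⇒At {x , suc y} h)
        at {suc f} f< = Move-at⁻ (C.follows f<) (at (<⇒≤ f<))

    Candidate : ℕ → ℕ → ℕ → Set
    Candidate j x y = (x , suc y) ∈λ la × Horiz (x , suc y) j × π (x , y) < π (x , suc y)

    search-rows : ∀ j a → 1 ≤ j → TrivialBelow π j a →
      TrivialBelow π j 0 ⊎ ∃[ x ] ∃[ y ] (Candidate j x y × TrivialBelow π j x)
    search-rows j zero    1≤j t = inj₁ t
    search-rows j (suc a) 1≤j t = go
      (((suc a , suc y₀) ∈λ? la) ×-dec (((1 ≤? j) ×-dec (j + suc a ≟ suc y₀ + M j)) ×-dec (π (suc a , y₀) <? π (suc a , suc y₀))))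
      where
      -- The only column in which row `suc a` can meet the diagonal of column j. If the subtraction
      -- is truncated, the equation tested below fails.
      y₀ = j + a ∸ M j
      y≡ : ∀ {y} → Horiz (suc a , suc y) j → y ≡ y₀
      y≡ {y} (_ , eq) = sym (trans (cong (_∸ M j) (suc-injective (trans (sym (+-suc j a)) eq))) (m+n∸n≡m y (M j)))
      go : Dec (Candidate j (suc a) y₀) → TrivialBelow π j 0 ⊎ ∃[ x ] ∃[ y ] (Candidate j x y × TrivialBelow π j x)
      go (yes c) = inj₂ (suc a , y₀ , c , t)
      go (no ¬c) = search-rows j a 1≤j t′
        where
        t′ : TrivialBelow π j a
        t′ {x} {y} a<x u∈ h with x ≟ suc a
        ... | no ≢ = t (≤∧≢⇒< a<x (≢ ∘ sym)) u∈ h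
        ... | yes refl with y≡ h
        ...   | refl = ≤-antisym (≮⇒≥ (λ lt → ¬c (u∈ , h , lt))) (St.east u∈)

    search-columns : ∀ j → Trivial π (suc j) → Trivial π 1 ⊎ ∃[ i ] ∃[ j ] Extract π i j
    search-columns zero    t = inj₁ t
    search-columns (suc j) t with search-rows (suc j) (M 1) (s≤s z≤n) (λ lt u∈ _ → ⊥-elim (<⇒≱ lt (row≤M1 u∈)))
    ... | inj₂ (x , y , (u∈ , h , lt) , below) = inj₂ (_ , suc j , proj₂ (extract-from t (s≤s z≤n) u∈ h lt below))
    ... | inj₁ t₀ = search-columns j t′
      where
      t′ : Trivial π (suc j)
      t′ {k} j≤k u∈ h with k ≟ suc j
      ... | yes refl = t₀ (proj₁ u∈) u∈ h
      ... | no ≢     = t (≤∧≢⇒< j≤k (≢ ∘ sym)) u∈ h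

    -- Columns beyond the first row have no diagonal in the shape, so the search begins at `L 1`. If
    -- it fails, `vanish` for column 1 leaves no nonzero entry on any diagonal.
    zero-or-extract : (∀ u → π u ≡ 0) ⊎ ∃[ i ] ∃[ j ] Extract π i j
    zero-or-extract with search-columns (L 1) none
      where
      none : Trivial π (suc (L 1))
      none {k} {x} {y} lt u∈@(1≤x , _ , y≤) (1≤k , eq) with M k in Mk
      ... | suc m = ⊥-elim (<⇒≱ lt (M⇒L {1} ≤-refl (≤-trans (s≤s z≤n) (≤-reflexive (sym Mk)))))
      ... | zero  = ⊥-elim (<⇒≱ lt (≤-trans (m≤m+n k x) (≤-trans (≤-reflexive (trans eq (+-identityʳ _)))
                      (≤-trans y≤ (L-anti ≤-refl 1≤x)))))
    ... | inj₂ X = inj₂ X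
    ... | inj₁ t = inj₁ all-zero
      where
      all-zero : ∀ u → π u ≡ 0
      all-zero u with u ∈λ? la
      all-zero u           | no ∉  = St.off ∉
      all-zero (x , suc y) | yes u∈ = vanish st ≤-refl t u∈ (s≤s (L⇒M (proj₁ u∈) (s≤s z≤n) (proj₂ (proj₂ u∈))))

  -- The classes A, B and I in terms of rim steps.

  unique-map : ∀ {A B : Set} {P : A → Set} (f : A → B) → (∀ {x y} → P x → P y → f x ≡ f y → x ≡ y) →
    ∀ {xs} → All P xs → Unique xs → Unique (map f xs)
  unique-map f inj All.[]         AllPairs.[]         = AllPairs.[]
  unique-map f inj (p All.∷ ps) (u AllPairs.∷ us) =
    All.map⁺ (All.map (λ { (q , ≢) eq → ≢ (inj p q eq) }) (All.zip (ps , u))) AllPairs.∷ unique-map f inj ps us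

  rowLen⇒≤length : ∀ la x → 1 ≤ rowLen la (suc x) → x < length la
  rowLen⇒≤length (_ ∷ _)  zero    _ = s≤s z≤n
  rowLen⇒≤length (_ ∷ xs) (suc x) p = s≤s (rowLen⇒≤length xs x p)

  ∈-cells⁺ : ∀ {u} → u ∈λ la → u ∈ cells la
  ∈-cells⁺ {suc x , suc y} (_ , _ , p) =
    ∈-concatMap⁺ _ (lose (∈-upTo⁺ (rowLen⇒≤length la x (≤-trans (s≤s z≤n) p))) (∈-map⁺ _ (∈-upTo⁺ p)))

  cells-unique : Unique (cells la)
  cells-unique = Unique.concat⁺ {xss = map rowCells (upTo (length la))}
    (All.map⁺ (All.universal (λ x → Unique.map⁺ (λ { refl → refl }) (Unique.upTo⁺ _)) _))
    (AllPairs.map⁺ (AllPairs.map disjoint (Unique.upTo⁺ (length la))))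
    where
    rowCells : ℕ → List Cell
    rowCells x = map (λ y → suc x , suc y) (upTo (rowLen la (suc x)))
    disjoint : ∀ {x x′} → x ≢ x′ → Disjoint (rowCells x) (rowCells x′)
    disjoint ≢ (p , q) with ∈-map⁻ _ p | ∈-map⁻ _ q
    ... | _ , _ , refl | _ , _ , refl = ≢ refl

  module _ where
    r : ℕ
    r = M 1

    diagonal : Cell → ℕ
    diagonal (x , y) = r ∸ x + y

    private
      c : ℕ → ℤ
      c k = k ⊖ r

      S : ℕ → Set
      S k = ∃[ i ] (1 ≤ i × L i + suc r ≡ k + i)

    open Corners S c (ℤ.⊖-monoˡ-< r)

    private
      diag-eq : ∀ {x y} → x ≤ r → diagonal (x , y) + x ≡ y + r
      diag-eq {x} {y} x≤ = trans (+-assoc (r ∸ x) y x) (trans (cong (r ∸ x +_) (+-comm y x))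
        (trans (sym (+-assoc (r ∸ x) x y)) (trans (cong (_+ y) (m∸n+n≡m x≤)) (+-comm r y))))

      content-c : ∀ {x y} → x ≤ r → content (x , y) ≡ c (diagonal (x , y))
      content-c {x} {y} x≤ = trans (sym (ℤ.+-cancelˡ-⊖ (r ∸ x) y x)) (cong (r ∸ x + y ⊖_) (m∸n+n≡m x≤))

      shift-eq : ∀ l r k i x y → k + x ≡ y + r → l + suc x ≡ y + i → l + suc r ≡ k + i
      shift-eq l r k i x y p q = lin-≡ (l + suc r) (k + i) (cong₂ _+_ (sym p) q) (solve (l ∷ r ∷ k ∷ i ∷ x ∷ y ∷ []))

      unshift-eq : ∀ l r k i x y → k + x ≡ y + r → l + suc r ≡ k + i → l + suc x ≡ y + i
      unshift-eq l r k i x y p q = lin-≡ (l + suc x) (y + i) (cong₂ _+_ p q) (solve (l ∷ r ∷ k ∷ i ∷ x ∷ y ∷ []))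

      Vert⇒S : ∀ {x y} → x ≤ r → Vert (x , y) → S (diagonal (x , y))
      Vert⇒S {x} {y} x≤ (i , 1≤i , eq) = i , 1≤i , shift-eq (L i) r _ i x y (diag-eq x≤) eq

      S⇒Vert : ∀ {x y} → x ≤ r → S (diagonal (x , y)) → Vert (x , y)
      S⇒Vert {x} {y} x≤ (i , 1≤i , eq) = i , 1≤i , unshift-eq (L i) r (diagonal (x , y)) i x y (diag-eq x≤) eq

      diagonal-east : ∀ x y → diagonal (x , suc y) ≡ suc (diagonal (x , y))
      diagonal-east x y = +-suc (r ∸ x) y

      -- Rows beyond the last have length 0, and their vertical steps come before diagonal 1. The
      -- bound makes the search for the row of a step finite.
      row-bound : ∀ {k i} → L i + suc r ≡ suc k + i → i ≤ r
      row-bound {k} {i} eq with i ≤? r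
      ... | yes p = p
      ... | no ¬p with L i in Li
      ...   | suc l = ⊥-elim (¬p (L⇒M {i} (≤-trans (s≤s z≤n) (≰⇒> ¬p)) ≤-refl (≤-trans (s≤s z≤n) (≤-reflexive (sym Li)))))
      ...   | zero  = ⊥-elim (¬p (≤-trans (m≤n+m i k) (≤-reflexive (suc-injective (sym eq)))))

      S? : ∀ k → Dec (S (suc k))
      S? k = map′ (λ { (i , _ , p) → i , p }) (λ { (i , p , eq) → i , s≤s (row-bound eq) , p , eq })
        (anyUpTo? (λ i → (1 ≤? i) ×-dec (L i + suc r ≟ suc k + i)) (suc r))

      -- In the numbering by `diagonal`, the cell at the foot of column 1 is on diagonal 1, so the
      -- scan starts in a horizontal run. This matches the lists of corners, which begin with an
      -- outer one.
      ¬S1 : ¬ S 1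
      ¬S1 (i , 1≤i , eq) = <⇒≱ (+-monoˡ-< (suc r) {0} {L i} (M⇒L {i} 1≤i i≤r)) (≤-trans (≤-reflexive eq) (s≤s i≤r))
        where i≤r = row-bound eq

      -- The largest diagonal is that of the end of the first row.
      size : ℕ
      size = pred (L 1) + r

      diagonal-range : ∀ {u} → u ∈λ la → 1 ≤ diagonal u × diagonal u < 1 + size
      diagonal-range {x , y} (1≤x , 1≤y , y≤) = ≤-trans 1≤y (m≤n+m y (r ∸ x)) , s≤s (bound (L 1) (≤-trans y≤ (L-anti ≤-refl 1≤x)) 1≤x)
        where
        bound : ∀ l → y ≤ l → 1 ≤ x → r ∸ x + y ≤ pred l + r
        bound l y≤l 1≤x = ≤-trans (+-mono-≤ (∸-monoʳ-≤ r 1≤x) y≤l) (go r l y≤l (≤-trans 1≤x (row≤M1 {x , y} (1≤x , 1≤y , y≤))))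
          where
          go : ∀ r l → y ≤ l → 1 ≤ r → r ∸ 1 + l ≤ pred l + r
          go (suc r) zero    p _ = ⊥-elim (<⇒≱ 1≤y p)
          go (suc r) (suc l) _ _ = ≤-reflexive (trans (+-suc r l) (trans (cong suc (+-comm r l)) (sym (+-suc l r))))

      Rim : Cell → Set
      Rim u = u ∈λ la × ¬ (ec (sc u) ∈λ la)

      rim-diagonal-≤ : ∀ {x y x′ y′} → Rim (x , y) → Rim (x′ , y′) → diagonal (x , y) ≡ diagonal (x′ , y′) → x′ ≤ x
      rim-diagonal-≤ {x} {y} {x′} {y′} (u∈ , es∉) (u′∈@(_ , _ , y′≤) , _) eq with x′ ≤? x
      ... | yes p = p
      ... | no ¬p = ⊥-elim (es∉ (s≤s z≤n , s≤s z≤n , ≤-trans y<y′ (≤-trans y′≤ (L-anti (s≤s z≤n) x<x′))))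
        where
        x<x′ = ≰⇒> ¬p
        farther : ∀ k r x y x′ y′ → k + x ≡ y + r → k + x′ ≡ y′ + r → x < x′ → y < y′
        farther k r x y x′ y′ p q lt =
          lin-≤ (suc y) y′ (≤-reflexive (sym p) ⊕ ≤-reflexive q ⊕ lt) 0 (solve (k ∷ r ∷ x ∷ y ∷ x′ ∷ y′ ∷ []))
        y<y′ : y < y′
        y<y′ = farther (diagonal (x , y)) r x y x′ y′ (diag-eq (row≤M1 u∈))
          (trans (cong (_+ x′) eq) (diag-eq (row≤M1 u′∈))) x<x′

      -- Each diagonal has one rim cell. Corners are rim cells, so their contents are distinct, as
      -- `sort-unique` requires.
      rim-unique : ∀ {u v} → Rim u → Rim v → content u ≡ content v → u ≡ v
      rim-unique {x , y} {x′ , y′} p q eq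
        with ≤-antisym (rim-diagonal-≤ q p (sym d≡)) (rim-diagonal-≤ p q d≡)
        where
        d≡ : diagonal (x , y) ≡ diagonal (x′ , y′)
        d≡ = c-injective (trans (sym (content-c (row≤M1 (proj₁ p)))) (trans eq (content-c (row≤M1 (proj₁ q)))))
      ... | refl = cong (x ,_) (+-cancelˡ-≡ (r ∸ x) y y′ (c-injective
        (trans (sym (content-c (row≤M1 (proj₁ p)))) (trans eq (content-c (row≤M1 (proj₁ q)))))))

      outer-rim : ∀ {u} → IsOuterCorner la u → Rim u
      outer-rim {x , y} (u∈ , e∉ , _) = u∈ , λ es∈ → e∉ (north-∈ es∈ (proj₁ u∈))

      inner-rim : ∀ {u} → IsInnerCorner la u → Rim u
      inner-rim (u∈ , _ , _ , es∉) = u∈ , es∉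

      outer-S : ∀ {u} → IsOuterCorner la u → ¬ S (diagonal u) × S (suc (diagonal u))
      outer-S {x , y} (u∈@(1≤x , 1≤y , y≤) , e∉ , s∉) =
        (λ s → Vert-¬Horiz {x , y} {y} (S⇒Vert x≤ s) (1≤y , cong (y +_)
          (≤-antisym (L⇒M 1≤x 1≤y y≤) (≤-pred (≰⇒> (λ q → s∉ (s≤s z≤n , 1≤y , M⇒L (s≤s z≤n) q))))))) ,
        subst S (diagonal-east x y) (Vert⇒S x≤ (Vert-rowEnd u∈ e∉))
        where x≤ = row≤M1 u∈

      inner-S : ∀ {u} → IsInnerCorner la u → S (diagonal u) × ¬ S (suc (diagonal u))
      inner-S {x , y} (u∈@(1≤x , 1≤y , y≤) , (_ , _ , e≤) , (_ , _ , s≤) , es∉) =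
        Vert⇒S x≤ (suc x , s≤s z≤n , cong (_+ suc x) (≤-antisym (≤-pred (≰⇒> (λ q → es∉ (s≤s z≤n , s≤s z≤n , q)))) s≤)) ,
        λ s → Vert-¬Horiz {x , suc y} {suc y} (S⇒Vert x≤ (subst S (sym (diagonal-east x y)) s))
          (s≤s z≤n , cong (suc y +_) (≤-antisym (L⇒M 1≤x (s≤s z≤n) e≤)
            (≤-pred (≰⇒> (λ q → es∉ (s≤s z≤n , s≤s z≤n , M⇒L (s≤s z≤n) q))))))
        where x≤ = row≤M1 u∈

      diagonal-unique : ∀ {k x y} → x ≤ r → k + x ≡ y + r → diagonal (x , y) ≡ k
      diagonal-unique {k} {x} {y} x≤ eq = +-cancelʳ-≡ x (diagonal (x , y)) k (trans (diag-eq x≤) (sym eq))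

      S-outer : ∀ {k} → 1 ≤ k → ¬ S k → S (suc k) → ∃[ u ] (IsOuterCorner la u × diagonal u ≡ k)
      S-outer {suc k} _ ¬sk (i , 1≤i , eq) = (i , L i) , (u∈ , rowEnd-∉ , s∉) , d≡
        where
        i≤r = row-bound eq
        u∈ : (i , L i) ∈λ la
        u∈ = 1≤i , M⇒L {i} 1≤i i≤r , ≤-refl
        d≡ : diagonal (i , L i) ≡ suc k
        d≡ = diagonal-unique i≤r (suc-injective (trans (sym eq) (+-suc (L i) r)))
        s∉ : ¬ ((suc i , L i) ∈λ la)
        s∉ (_ , _ , p) = ¬sk (subst S d≡ (Vert⇒S i≤r (suc i , s≤s z≤n , cong (_+ suc i) (≤-antisym (L-anti 1≤i (n≤1+n i)) p))))

      S-inner : ∀ {k} → 1 ≤ k → k < 1 + size → S k → ¬ S (suc k) → ∃[ u ] (IsInnerCorner la u × diagonal u ≡ k)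
      -- The vertical step of the first row comes after the last diagonal, so it cannot enter an
      -- inner corner.
      S-inner {k} 1≤k k< (suc zero , _ , eq) _ = ⊥-elim (go (L 1) refl (≤-trans 1≤k (≤-pred k<)) eq (≤-pred k<))
        where
        past : ∀ l r k → suc l + suc r ≡ k + 1 → k ≤ l + r → ⊥
        past l r k p q = lin-⊥ (≤-reflexive p ⊕ q) 0 (solve (l ∷ r ∷ k ∷ []))
        go : ∀ l → l ≡ L 1 → 1 ≤ pred l + r → l + suc r ≡ k + 1 → k ≤ pred l + r → ⊥
        go zero    e 1≤r _  _  = n≮0 (subst (1 ≤_) (sym e) (M⇒L {1} ≤-refl 1≤r))
        go (suc l) _ _   eq k≤ = past l r k eq k≤
      S-inner {suc k} _ k< (suc (suc i) , _ , eq) ¬s = (suc i , l) , (u∈ , e∈ , s∈ , es∉) , d≡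
        where
        l = L (suc (suc i))
        i≤r = row-bound eq
        1≤l : 1 ≤ l
        1≤l = M⇒L {suc (suc i)} (s≤s z≤n) i≤r
        u∈ : (suc i , l) ∈λ la
        u∈ = s≤s z≤n , 1≤l , L-anti (s≤s z≤n) (n≤1+n _)
        s∈ : (suc (suc i) , l) ∈λ la
        s∈ = s≤s z≤n , 1≤l , ≤-refl
        es∉ : ¬ ((suc (suc i) , suc l) ∈λ la)
        es∉ = rowEnd-∉
        d≡ : diagonal (suc i , l) ≡ suc k
        d≡ = diagonal-unique (<⇒≤ i≤r) (suc-injective (trans (sym (+-suc (suc k) (suc i))) (trans (sym eq) (+-suc l r))))
        e∈ : (suc i , suc l) ∈λ la
        e∈ with (suc i , suc l) ∈λ? la
        ... | yes p = p
        ... | no ¬p = ⊥-elim (¬s (subst S (trans (diagonal-east (suc i) l) (cong suc d≡)) (Vert⇒S (<⇒≤ i≤r) (Vert-rowEnd u∈ ¬p))))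

      scanned = scan S? 0 size
      os = proj₁ scanned
      is = proj₁ (proj₂ scanned)
      scanned-scan : Scan 1 size os is
      scanned-scan = proj₂ (proj₂ scanned)

      contents-scan : ∀ {P : Cell → Set} (P? : ∀ u → Dec (P u)) {ks} → (∀ {u} → P u → Rim u) →
        AllPairs _<ℤ_ (map c ks) → (∀ {u} → P u → diagonal u ∈ ks) → (∀ {k} → k ∈ ks → ∃[ u ] (P u × diagonal u ≡ k)) →
        sort (map content (filter P? (cells la))) ≡ map c ks
      contents-scan P? {ks} rim ks< into onto = sort-unique
        (unique-map content (λ p q → rim-unique (rim p) (rim q)) (All.all-filter P? (cells la)) (Unique.filter⁺ P? cells-unique))
        ks< to from
        where
        to : ∀ {z} → z ∈ map content (filter P? (cells la)) → z ∈ map c ks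
        to m with ∈-map⁻ content m
        ... | u , u∈ , refl with ∈-filter⁻ P? {xs = cells la} u∈
        ...   | _ , p = subst (_∈ map c ks) (sym (content-c (row≤M1 (proj₁ (rim p))))) (∈-map⁺ c (into p))
        from : ∀ {z} → z ∈ map c ks → z ∈ map content (filter P? (cells la))
        from m with ∈-map⁻ c m
        ... | k , k∈ , refl with onto k∈
        ...   | u , p , refl = subst (_∈ _) (content-c (row≤M1 (proj₁ (rim p))))
          (∈-map⁺ content (∈-filter⁺ P? (∈-cells⁺ (proj₁ (rim p))) p))

      outerContents-scan : outerContents la ≡ map c os
      outerContents-scan = contents-scan (outer? la) outer-rim (os-< scanned-scan)
        (λ o → let (1≤ , k<) = diagonal-range (proj₁ o) ; (¬s , s) = outer-S o in os-∈⁺ scanned-scan 1≤ k< ¬s s)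
        (λ k∈ → let (1≤ , _ , ¬s , s) = os-∈⁻ scanned-scan k∈ in S-outer 1≤ ¬s s)

      innerContents-scan : innerContents la ≡ map c is
      innerContents-scan = contents-scan (inner? la) inner-rim (is-< scanned-scan)
        (λ o → let (1≤ , k<) = diagonal-range (proj₁ o) ; (s , ¬s) = inner-S o in is-∈⁺ scanned-scan 1≤ k< s ¬s)
        (λ k∈ → let (1≤ , k< , s , ¬s) = is-∈⁻ scanned-scan k∈ in S-inner 1≤ k< s ¬s)

    InBI⇒Vert : ∀ {u} → InB la u ⊎ InI la u → Vert u
    InBI⇒Vert {u} h = S⇒Vert (row≤M1 (u∈ h)) (BI-sound scanned-scan (proj₁ (diagonal-range (u∈ h))) (proj₂ (diagonal-range (u∈ h))) ¬S1
        (subst₂ (λ z (l : List ℤ × List ℤ) → InB-content z (proj₁ l) (proj₂ l) ⊎ InI-content z (proj₂ l))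
          (content-c (row≤M1 (u∈ h))) (cong₂ _,_ outerContents-scan innerContents-scan) (h′ h)))
      where
      u∈ : InB la u ⊎ InI la u → u ∈λ la
      u∈ (inj₁ (p , _)) = p
      u∈ (inj₂ (p , _)) = p
      h′ : InB la u ⊎ InI la u → InB-content (content u) (outerContents la) (innerContents la) ⊎ InI-content (content u) (innerContents la)
      h′ (inj₁ (_ , p)) = inj₁ p
      h′ (inj₂ (_ , p)) = inj₂ p

    Vert⇒InBI : ∀ {u} → u ∈λ la → Vert u → InB la u ⊎ InI la u
    Vert⇒InBI {u} u∈ v = h′ (subst₂ (λ z (l : List ℤ × List ℤ) → InB-content z (proj₁ l) (proj₂ l) ⊎ InI-content z (proj₂ l))
          (sym (content-c (row≤M1 u∈))) (sym (cong₂ _,_ outerContents-scan innerContents-scan))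
          (BI-complete scanned-scan (proj₁ (diagonal-range u∈)) (proj₂ (diagonal-range u∈)) ¬S1 (Vert⇒S (row≤M1 u∈) v)))
      where
      h′ : InB-content (content u) (outerContents la) (innerContents la) ⊎ InI-content (content u) (innerContents la) → InB la u ⊎ InI la u
      h′ (inj₁ p) = inj₁ (u∈ , p)
      h′ (inj₂ p) = inj₂ (u∈ , p)

    InIA⇒¬Vert : ∀ {u} → InI la u ⊎ InA la u → ¬ Vert (ec u)
    InIA⇒¬Vert {u} h v = AI-sound scanned-scan (proj₁ (diagonal-range (u∈ h))) (proj₂ (diagonal-range (u∈ h))) ¬S1
        (subst₂ (λ z (l : List ℤ × List ℤ) → InA-content z (proj₂ l) (proj₁ l) ⊎ InI-content z (proj₂ l))
          (content-c (row≤M1 (u∈ h))) (cong₂ _,_ outerContents-scan innerContents-scan) (h′ h))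
        (subst S (diagonal-east (proj₁ u) (proj₂ u)) (Vert⇒S (row≤M1 (u∈ h)) v))
      where
      u∈ : InI la u ⊎ InA la u → u ∈λ la
      u∈ (inj₁ (p , _)) = p
      u∈ (inj₂ (p , _)) = p
      h′ : InI la u ⊎ InA la u → InA-content (content u) (innerContents la) (outerContents la) ⊎ InI-content (content u) (innerContents la)
      h′ (inj₁ (_ , p)) = inj₂ p
      h′ (inj₂ (_ , p)) = inj₁ p

  -- Rim-hooks and the cells that label them.

  last-∷ : ∀ {A : Set} (x y : A) zs → last (x List⁺.∷ y ∷ zs) ≡ last (y List⁺.∷ zs)
  last-∷ x y zs with initLast zs
  ... | []            = refl
  ... | _ List.∷ʳ′ _ = refl

  module _ where
    private
      go-north : ∀ x′ y n x y′ → x′ + y + n ≡ x + y′ → x′ + y + suc n ≡ suc x + y′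
      go-north x′ y n x y′ eq = trans (+-suc (x′ + y) n) (cong suc eq)
      go-east : ∀ x′ y n x y′ → x′ + suc y + n ≡ x + y′ → x′ + y + suc n ≡ x + y′
      go-east x′ y n x y′ eq = trans (trans (+-suc (x′ + y) n) (cong (_+ n) (sym (+-suc x′ y)))) eq

    -- (x , y) is the head and (x′ , y′) the tail of a north-east path with n steps.
    Spans : Cell → Cell → ℕ → Set
    Spans (x , y) (x′ , y′) n = x′ + y + n ≡ x + y′ × x′ ≤ x × (x′ , y′) ∈λ la

    ne-spans : ∀ {u us} → u ∈λ la → NESteps la u us → Spans u (last (u List⁺.∷ us)) (length us)
    ne-spans {x , y} u∈ done = +-identityʳ (x + y) , ≤-refl , u∈
    ne-spans {u} {v ∷ vs} u∈ (step m v∈ s) =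
      subst (λ w → Spans u w (suc (length vs))) (sym (last-∷ u v vs)) (go u (last (v List⁺.∷ vs)) m v∈ (ne-spans v∈ s))
      where
      go : ∀ u w → v ≡ nc u ⊎ v ≡ ec u → v ∈λ la → Spans v w (length vs) → Spans u w (suc (length vs))
      go (x , y) (x′ , y′) (inj₂ refl) _ (eq , le , w∈) = go-east x′ y (length vs) x y′ eq , le , w∈
      go (suc x , y) (x′ , y′) (inj₁ refl) _ (eq , le , w∈) = go-north x′ y (length vs) x y′ eq , m≤n⇒m≤1+n le , w∈
      go (zero , y) (x′ , y′) (inj₁ refl) (() , _) _

    hook-at : ∀ {i j h} → IsHookOf la (i , j) h → At j (ℓ h) (i , L i)
    hook-at {i} {j} {a List⁺.∷ as} (((a∈ , s) , _) , refl , ω≡) = shape i j (length as) (M j) (L i)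
        (proj₁ (subst (λ w → Spans a w (length as)) ω≡ (ne-spans a∈ s)))
      where
      shape : ∀ i j n m l → i + j + n ≡ m + l → j + i + n ≡ l + m
      shape i j n m l eq = trans (cong (_+ n) (+-comm j i)) (trans eq (+-comm m l))

  rimhook-cell : ∀ {h} → IsRimHook la h → ∃[ u ] (u ∈λ la × IsHookOf la u h)
  rimhook-cell {a@(x , y) List⁺.∷ as} hook@((a∈@(1≤x , 1≤y , y≤) , s) , s∉ , e∉ , _) = go _ refl (ne-spans a∈ s)
    where
    x≡ : x ≡ M y
    x≡ = ≤-antisym (L⇒M 1≤x 1≤y y≤) (≤-pred (≰⇒> (λ q → s∉ (s≤s z≤n , 1≤y , M⇒L (s≤s z≤n) q))))
    go : ∀ w → last (a List⁺.∷ as) ≡ w → Spans a w (length as) → ∃[ u ] (u ∈λ la × IsHookOf la u (a List⁺.∷ as))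
    go (x′ , y′) ω≡ (eq , x′≤ , 1≤x′ , 1≤y′ , y′≤) = (x′ , y) , (1≤x′ , 1≤y , ≤-trans y≤ (L-anti 1≤x′ x′≤)) ,
      hook , cong (_, y) x≡ , trans ω≡ (cong (x′ ,_) (≤-antisym y′≤
        (≤-pred (≰⇒> (λ q → e∉ (subst (λ w → ec w ∈λ la) (sym ω≡) (1≤x′ , s≤s z≤n , q)))))))

  -- The rim never branches: `ec u` is the south-east neighbour of `nc u`, so if both were in the
  -- shape the north neighbour would not be on the rim.
  rim-steps-unique : ∀ {u us us′} → u ∈λ la → NESteps la u us → NESteps la u us′ →
    (∀ v → v ∈ u ∷ us → ¬ (ec (sc v) ∈λ la)) → (∀ v → v ∈ u ∷ us′ → ¬ (ec (sc v) ∈λ la)) →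
    length us ≡ length us′ → us ≡ us′
  rim-steps-unique u∈ done done _ _ _ = refl
  rim-steps-unique {u} u∈ (step {v = v} {vs} m v∈ s) (step {v = v′} {vs′} m′ v′∈ s′) rim rim′ eq
    with same u m m′ v∈ v′∈
    where
    clash : ∀ u {v v′} → v ≡ nc u → v′ ≡ ec u → v ∈λ la → v′ ∈λ la → ec (sc v) ∈λ la
    clash (suc x , y) refl refl v∈ v′∈ = v′∈
    clash (zero , y) refl refl (() , _) v′∈
    same : ∀ u → v ≡ nc u ⊎ v ≡ ec u → v′ ≡ nc u ⊎ v′ ≡ ec u → v ∈λ la → v′ ∈λ la → v ≡ v′
    same u (inj₁ p) (inj₁ q) _ _ = trans p (sym q)
    same u (inj₂ p) (inj₂ q) _ _ = trans p (sym q)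
    same u (inj₁ p) (inj₂ q) v∈ v′∈ = ⊥-elim (rim v (there (here refl)) (clash u p q v∈ v′∈))
    same u (inj₂ p) (inj₁ q) v∈ v′∈ = ⊥-elim (rim′ v′ (there (here refl)) (clash u q p v′∈ v∈))
  ... | refl = cong (v ∷_) (rim-steps-unique v∈ s s′ (λ w m → rim w (there m)) (λ w m → rim′ w (there m)) (suc-injective eq))

  hook-unique : ∀ {u h h′} → IsHookOf la u h → IsHookOf la u h′ → h ≡ h′
  hook-unique {i , j} {a List⁺.∷ as} {b List⁺.∷ bs} H@(((a∈ , s) , _ , _ , rim) , refl , _) H′@(((_ , s′) , _ , _ , rim′) , refl , _) =
    cong (a List⁺.∷_) (rim-steps-unique a∈ s s′ rim rim′ (At-unique {j} {u = i , L i} (hook-at H) (hook-at H′)))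

  hook-cell-unique : ∀ {u v h} → IsHookOf la u h → IsHookOf la v h → u ≡ v
  hook-cell-unique (_ , α≡ , ω≡) (_ , α≡′ , ω≡′) =
    cong₂ _,_ (cong proj₁ (trans (sym ω≡) ω≡′)) (cong proj₂ (trans (sym α≡) α≡′))

  module _ where
    private
      at-end : ∀ l i x y → l + x ≡ y + i + 0 → i ≤ x → l ≤ y
      at-end l i x y p q = lin-≤ l y (≤-reflexive p ⊕ q) 0 (solve (l ∷ i ∷ x ∷ y ∷ []))
      at-row : ∀ l i x → l + x ≡ l + i + 0 → x ≡ i
      at-row l i x eq = +-cancelˡ-≡ l x i (trans eq (+-identityʳ (l + i)))
      not-end : ∀ l i g → l + i ≡ l + i + suc g → ⊥
      not-end l i g eq = <-irrefl eq (m<m+n (l + i) (s≤s z≤n))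

    -- Going east whenever possible stays on the rim, since a north step is taken only from a row
    -- end. The number g counts the remaining steps.
    rim-walk : ∀ g {i x y} → 1 ≤ i → i ≤ x → (x , y) ∈λ la → ¬ ((suc x , suc y) ∈λ la) → L i + x ≡ y + i + g →
      ∃[ us ] (NESteps la (x , y) us × last ((x , y) List⁺.∷ us) ≡ (i , L i) ×
               (∀ v → v ∈ (x , y) ∷ us → ¬ (ec (sc v) ∈λ la)))
    rim-walk zero {i} {x} {y} 1≤i i≤x (_ , _ , y≤) es∉ eq
      with ≤-antisym (≤-trans y≤ (L-anti 1≤i i≤x)) (at-end (L i) i x y eq i≤x)
    ... | refl = [] , done , cong (_, L i) (at-row (L i) i x eq) , λ { _ (here refl) → es∉ }
    rim-walk (suc g) {i} {x} {y} 1≤i i≤x u∈ es∉ eq with (x , suc y) ∈λ? la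
    ... | yes e∈ with rim-walk g 1≤i i≤x e∈ (λ { (p , q , le) → es∉ (p , s≤s z≤n , ≤-trans (n≤1+n _) le) }) (trans eq (+-suc (y + i) g))
    ...   | us , s , l , rim = (x , suc y) ∷ us , step (inj₂ refl) e∈ s , trans (last-∷ (x , y) (x , suc y) us) l ,
            λ { _ (here refl) → es∉ ; v (there m) → rim v m }
    rim-walk (suc g) {i} {x} {y} 1≤i i≤x u∈ es∉ eq | no e∉ with m≤n⇒m<n∨m≡n i≤x
    ... | inj₂ refl = ⊥-elim (not-end (L i) i g (subst (λ z → L i + i ≡ z + i + suc g) y≡ eq))
      where
      y≡ : y ≡ L i
      y≡ = ≤-antisym (proj₂ (proj₂ u∈)) (≤-pred (≰⇒> (λ q → e∉ (proj₁ u∈ , s≤s z≤n , q))))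
    rim-walk (suc g) {i} {suc x} {y} 1≤i _ u∈ es∉ eq | no e∉ | inj₁ (s≤s i≤x)
      with rim-walk g 1≤i i≤x n∈ e∉ (suc-injective (trans (sym (+-suc (L i) x)) (trans eq (+-suc (y + i) g))))
      where n∈ = north-∈ u∈ (≤-trans 1≤i i≤x)
    ... | us , s , l , rim = (x , y) ∷ us , step (inj₁ refl) (north-∈ u∈ (≤-trans 1≤i i≤x)) s , trans (last-∷ (suc x , y) (x , y) us) l ,
            λ { _ (here refl) → es∉ ; v (there m) → rim v m }

    hook-exists : ∀ {u} → u ∈λ la → ∃[ h ] IsHookOf la u h
    hook-exists {i , j} (1≤i , 1≤j , j≤) = α List⁺.∷ proj₁ w ,
      ((α∈ , proj₁ (proj₂ w)) , s∉ , (λ e∈ → rowEnd-∉ (subst (λ v → ec v ∈λ la) ω≡ e∈)) , proj₂ (proj₂ (proj₂ w))) , refl , ω≡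
      where
      α : Cell
      α = M j , j
      i≤ : i ≤ M j
      i≤ = L⇒M 1≤i 1≤j j≤
      α∈ : α ∈λ la
      α∈ = ≤-trans 1≤i i≤ , 1≤j , M⇒L (≤-trans 1≤i i≤) ≤-refl
      s∉ : ¬ (sc α ∈λ la)
      s∉ (_ , _ , p) = 1+n≰n (L⇒M {suc (M j)} (s≤s z≤n) 1≤j p)
      w = rim-walk (L i + M j ∸ (j + i)) 1≤i i≤ α∈ (λ { (p , q , r) → s∉ (p , 1≤j , ≤-trans (n≤1+n _) r) })
        (sym (m+[n∸m]≡n (+-mono-≤ j≤ i≤)))
      ω≡ : last (α List⁺.∷ proj₁ w) ≡ (i , L i)
      ω≡ = proj₁ (proj₂ (proj₂ w))

  -- The constructed path as a route, and compatibility.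

  nextCell-fwd : ∀ {π} → State π → ∀ {u} → u ∈λ la → Fwd π u (nextCell la π u)
  nextCell-fwd {π} st {u@(x , suc y)} u∈ with InBI? la u | sc u ∈λ? la | π u ≟ π (sc u)
  ... | yes b | yes s∈ | yes eq = south (InBI⇒Vert b) eq
  ... | yes b | yes s∈ | no ≢   = westV (InBI⇒Vert b) (≤∧≢⇒< (State.south st s∈) ≢)
  ... | yes b | no s∉  | _      = ⊥-elim (s∉ (Vert-south u∈ (InBI⇒Vert b)))
  ... | no ¬b | _      | _ with vert-or-horiz u∈
  ...   | inj₁ v       = ⊥-elim (¬b (Vert⇒InBI u∈ v))
  ...   | inj₂ (k , h) = westH h

  fwd-unique : ∀ {π u v w} → Fwd π u v → Fwd π u w → v ≡ w
  fwd-unique (south _ _)  (south _ _)  = refl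
  fwd-unique (south _ eq) (westV _ lt) = ⊥-elim (<-irrefl eq lt)
  fwd-unique (south v _)  (westH h)    = ⊥-elim (Vert-¬Horiz v h)
  fwd-unique (westV _ lt) (south _ eq) = ⊥-elim (<-irrefl eq lt)
  fwd-unique (westH h)    (south v _)  = ⊥-elim (Vert-¬Horiz v h)
  fwd-unique (westV _ _)  (westV _ _)  = refl
  fwd-unique (westV _ _)  (westH _)    = refl
  fwd-unique (westH _)    (westV _ _)  = refl
  fwd-unique (westH _)    (westH _)    = refl

  module _ {A : Set} (f : A → A) where

    fold-shift : ∀ x n → fold (f x) f n ≡ f (fold x f n)
    fold-shift x zero    = refl
    fold-shift x (suc n) = cong f (fold-shift x n)

    trail : ℕ → A → List A
    trail zero    x = x ∷ []
    trail (suc n) x = x ∷ trail n (f x)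

    ∈-trail⁻ : ∀ {v} n x → v ∈ trail n x → ∃[ k ] (k ≤ n × v ≡ fold x f k)
    ∈-trail⁻ zero    x (here eq) = 0 , z≤n , eq
    ∈-trail⁻ (suc n) x (here eq) = 0 , z≤n , eq
    ∈-trail⁻ (suc n) x (there m) with ∈-trail⁻ n (f x) m
    ... | k , k≤ , eq = suc k , s≤s k≤ , trans eq (fold-shift x k)

    ∈-trail⁺ : ∀ n x {k} → k ≤ n → fold x f k ∈ trail n x
    ∈-trail⁺ zero    x {zero}  _        = here refl
    ∈-trail⁺ (suc n) x {zero}  _        = here refl
    ∈-trail⁺ (suc n) x {suc k} (s≤s k≤) = there (subst (_∈ trail n (f x)) (fold-shift x k) (∈-trail⁺ n (f x) k≤))

  buildSW-trail : ∀ π n u → toList (buildSW la π n u) ≡ trail (nextCell la π) n u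
  buildSW-trail π zero    u = refl
  buildSW-trail π (suc n) u = cong (u ∷_) (buildSW-trail π n (nextCell la π u))

  module _ {π : RPP} {i j : ℕ} (R : Route i j) (moves : Follows R (Fwd π))
    (next : Cell → Cell) (next-fwd : ∀ {u} → u ∈λ la → Fwd π u (next u)) where
    open Route R

    cell≡fold : ∀ {f} → f ≤ len → cell f ≡ fold (i , L i) next (len ∸ f)
    cell≡fold = descend (λ f → cell f ≡ fold (i , L i) next (len ∸ f)) len
      (trans top (cong (fold (i , L i) next) (sym (n∸n≡0 len))))
      (λ {f} f< eq → trans (fwd-unique (moves f<) (next-fwd (mem f<)))
        (trans (cong next eq) (cong (fold (i , L i) next) (sym (+-∸-assoc 1 f<)))))

    on⇒trail : ∀ {v} → On v → v ∈ trail next len (i , L i)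
    on⇒trail (f , f≤ , refl) = subst (_∈ trail next len (i , L i)) (sym (cell≡fold f≤)) (∈-trail⁺ next len (i , L i) (m∸n≤m len f))

    trail⇒on : ∀ {v} → v ∈ trail next len (i , L i) → On v
    trail⇒on m with ∈-trail⁻ next len (i , L i) m
    ... | k , k≤ , eq = len ∸ k , m∸n≤m len k ,
      trans eq (sym (trans (cell≡fold (m∸n≤m len k)) (cong (fold (i , L i) next) (m∸[m∸n]≡n k≤))))

  +P-adds : ∀ {i j} (R : Route i j) {π P} → (∀ {v} → Route.On R v → v ∈P P) → (∀ {v} → v ∈P P → Route.On R v) →
    Adds R π (π +P P)
  +P-adds R {π} {P} to from = record
    { on  = λ {v} o → cong (λ b → if b then suc (π v) else π v) (dec-true (v ∈P? P) (to o))
    ; out = λ {v} ¬o → cong (λ b → if b then suc (π v) else π v) (dec-false (v ∈P? P) (¬o ∘ from))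
    }

  state⇒RPP : ∀ {π} → State π → IsRPP la π
  state⇒RPP st (x , y) _ = State.east st , State.south st

  module _ {π : RPP} (st : State π) {i j : ℕ} (R : Route i j) (moves : Follows R (Fwd π)) {h : Path} (hook : IsHookOf la (i , j) h) where
    open Route R

    len≡ℓ : len ≡ ℓ h
    len≡ℓ = At-unique {j} {u = i , L i} top-at (hook-at hook)

    insert-adds : Adds R π (h *[ la ] π)
    insert-adds = +P-adds R
      (λ {v} o → subst (v ∈_) (sym Pof≡) (on⇒trail R moves (nextCell la π) (nextCell-fwd st) o))
      (λ {v} m → trail⇒on R moves (nextCell la π) (nextCell-fwd st) (subst (v ∈_) Pof≡ m))
      where
      Pof≡ : toList (Pof la h π) ≡ trail (nextCell la π) len (i , L i)
      Pof≡ = trans (buildSW-trail π (ℓ h) (ωNE h)) (cong₂ (trail (nextCell la π)) (sym len≡ℓ) (proj₂ (proj₂ hook)))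

    private
      rest : ℕ → ℕ → List Cell
      rest zero    f = []
      rest (suc n) f = cell (suc f) ∷ rest n (suc f)

      rest-length : ∀ n f → length (rest n f) ≡ n
      rest-length zero    f = refl
      rest-length (suc n) f = cong suc (rest-length n (suc f))

      rest-last : ∀ n f → last (cell f List⁺.∷ rest n f) ≡ cell (f + n)
      rest-last zero    f = cong cell (sym (+-identityʳ f))
      rest-last (suc n) f = trans (last-∷ (cell f) (cell (suc f)) (rest n (suc f)))
        (trans (rest-last n (suc f)) (cong cell (sym (+-suc f n))))

      rest-∈⁻ : ∀ n f {v} → v ∈ cell f ∷ rest n f → ∃[ g ] (g ≤ f + n × v ≡ cell g)
      rest-∈⁻ n       f (here eq) = f , m≤m+n f n , eq
      rest-∈⁻ (suc n) f (there m) with rest-∈⁻ n (suc f) m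
      ... | g , g≤ , eq = g , ≤-trans g≤ (≤-reflexive (sym (+-suc f n))) , eq

      rest-∈⁺ : ∀ n f {g} → f ≤ g → g ≤ f + n → cell g ∈ cell f ∷ rest n f
      rest-∈⁺ n f f≤ g≤ with m≤n⇒m<n∨m≡n f≤
      ... | inj₂ refl = here refl
      rest-∈⁺ zero f f≤ g≤ | inj₁ lt = ⊥-elim (<⇒≱ lt (≤-trans g≤ (≤-reflexive (+-identityʳ f))))
      rest-∈⁺ (suc n) f f≤ g≤ | inj₁ lt = there (rest-∈⁺ n (suc f) lt (≤-trans g≤ (≤-reflexive (+-suc f n))))

      ne-step : ∀ {u v} → Fwd π u v → u ≡ nc v ⊎ u ≡ ec v
      ne-step (south _ _) = inj₁ refl
      ne-step (westV _ _) = inj₂ refl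
      ne-step (westH _)   = inj₂ refl

      rest-steps : ∀ n f → f + n ≤ len → NESteps la (cell f) (rest n f)
      rest-steps zero    f _ = done
      rest-steps (suc n) f le = step (ne-step (moves f<)) (mem f<) (rest-steps n (suc f) le′)
        where
        le′ : suc f + n ≤ len
        le′ = ≤-trans (≤-reflexive (sym (+-suc f n))) le
        f< : f < len
        f< = ≤-trans (m≤m+n (suc f) n) le′

    -- The witness for `Inserts` has to run north-east, so it lists the cells of the route by
    -- increasing index.
    nePath : Path
    nePath = cell 0 List⁺.∷ rest len 0

    nePath-on : ∀ {v} → v ∈P nePath → On v
    nePath-on = rest-∈⁻ len 0

    on-nePath : ∀ {v} → On v → v ∈P nePath
    on-nePath (f , f≤ , refl) = rest-∈⁺ len 0 z≤n f≤

    module _ (right : Trivial π (suc j)) where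

      -- For condition (1) the next diagonal is not entered vertically, so the cell is not the row
      -- end and was reached by a west move on a horizontal diagonal; `right` gives the equality.
      -- For condition (2) vertically adjacent cells are consecutive on the route, and the move
      -- between them is a south move.
      compatible : Compatible la nePath π
      compatible = (λ v m ia → let (o , eq) = east v (nePath-on m) (InIA⇒¬Vert ia) in on-nePath o , eq) ,
                   (λ v m m′ → vertical v (nePath-on m) (nePath-on m′))
        where
        east : ∀ v → On v → ¬ Vert (ec v) → On (ec v) × π v ≡ π (ec v)
        east v (f , f≤ , eq) ¬v with f ≟ len
        ... | yes refl = ⊥-elim (¬v (subst (Vert ∘ ec) (sym (trans eq top))
                (Vert-rowEnd (subst (_∈λ la) top (mem ≤-refl)) rowEnd-∉)))
        ... | no ≢ = go refl (subst (Fwd π (cell (suc f))) (sym eq) (moves f<))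
          where
          f< = ≤∧≢⇒< f≤ ≢
          go : ∀ {u} → u ≡ cell (suc f) → Fwd π u v → On (ec v) × π v ≡ π (ec v)
          go e (south w _) = ⊥-elim (¬v (Vert-es w))
          go e (westV w _) = ⊥-elim (¬v w)
          go {u} e (westH h) = (suc f , f< , e) , sym (right
            (Horiz-later {f = f} {u} (proj₁ h) (subst (At j (suc f)) (sym e) (at f<)) h) (subst (_∈λ la) (sym e) (mem f<)) h)
        vertical : ∀ v → On v → On (sc v) → π v ≡ π (sc v)
        vertical v (zero , f≤ , eq) (g , g≤ , eq′)
          with At-unique {j} {0} {suc g} {v} (subst (At j 0) (sym eq) (at f≤)) (At-north {f = g} {proj₁ v} (subst (At j g) (sym eq′) (at g≤)))
        ... | ()
        vertical v (suc f , f< , eq) o′ = go (subst₂ (Fwd π) (sym eq) (sym s≡) (moves f<))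
          where
          s≡ : sc v ≡ cell f
          s≡ = on-at o′ (At-south {f = f} {proj₁ v} (subst (At j (suc f)) (sym eq) (at f<)))
          go : ∀ {v} → Fwd π v (sc v) → π v ≡ π (sc v)
          go (south _ q) = q

      inserts : TrivialBelow π j (row (cell 0)) → Inserts la h π
      inserts below =
        nePath ,
        (mem z≤n , rest-steps len 0 ≤-refl) ,
        trans (rest-last len 0) (trans top (sym (proj₂ (proj₂ hook)))) ,
        trans (rest-length len 0) len≡ℓ ,
        compatible ,
        state⇒RPP (Insertion.state st R (+P-adds R on-nePath nePath-on) moves right below)

  -- Chains of hooks: insertion, uniqueness and existence.

  -- π, obtained from hooks that are all ≥ (i , j), is ready for the insertion of the hook of (i , j).
  record Ready (π : RPP) (i j : ℕ) : Set₁ where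
    field
      right   : Trivial π (suc j)
      barrier : ∀ {len} → At j len (i , L i) → Barrier π i j len

  ready-zero : ∀ {i j} → (i , j) ∈λ la → State zeroRPP → Ready zeroRPP i j
  ready-zero (1≤i , 1≤j , _) st = record
    { right = λ _ _ _ → refl ; barrier = λ _ → trivial-barrier st 1≤i 1≤j (λ _ _ _ → refl) }

  ready-extract : ∀ {π i j i′ j′} → State π → (i , j) ∈λ la → Extract π i′ j′ → (i , j) ≤rl (i′ , j′) → Ready π i j
  ready-extract st u∈@(1≤i , 1≤j , _) X (inj₁ j>) = record
    { right = λ p → Extract.right X (≤-trans j> (<⇒≤ p))
    ; barrier = λ _ → trivial-barrier st 1≤i 1≤j (λ p → Extract.right X (≤-trans j> p)) }
  ready-extract st u∈ X (inj₂ (refl , i≥)) = record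
    { right = Extract.right X ; barrier = λ p → extract-barrier u∈ p X i≥ }

  Extraction : RPP → RPP → Cell → Set
  Extraction π π′ (i , j) = Σ[ X ∈ Extract π′ i j ] Adds (Extract.route X) π π′

  insert-hook : ∀ {π i j h} → State π → (i , j) ∈λ la → Ready π i j → IsHookOf la (i , j) h →
    Inserts la h π × State (h *[ la ] π) × Extraction π (h *[ la ] π) (i , j)
  insert-hook {π} {i} {j} {h} st u∈ ready hook = inserts st R moves hook right below , I.state , I.extract , A
    where
    open Ready ready
    p = hook-at hook
    R = forward-route u∈ p (barrier p) (nextCell la π) (nextCell-fwd st)
    moves : Follows R (Fwd π)
    moves = forward-follows u∈ p (barrier p) (nextCell la π) (nextCell-fwd st)
    below : TrivialBelow π j (row (Route.cell R 0))
    below = forward-below u∈ p (barrier p) (nextCell la π) (nextCell-fwd st)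
    A : Adds R π (h *[ la ] π)
    A = insert-adds st R moves hook
    module I = Insertion st R A moves right below

  zero-state : State zeroRPP
  zero-state = record { off = λ _ → refl ; east = λ _ → z≤n ; south = λ _ → z≤n }

  Last : List Path → Set
  Last []       = ⊥
  Last (h ∷ hs) = ∃[ u ] (IsHookOf la u h × Extraction (insertAll la hs) (insertAll la (h ∷ hs)) u)

  -- The induction needs the extraction of the hook inserted last: compared with the next hook, it
  -- provides the barrier for the next insertion.
  Sorted⇒ : List Path → Set
  Sorted⇒ hs = State (insertAll la hs) × ValidChain la hs × (hs ≡ [] ⊎ Last hs)

  sorted-cons : ∀ h h′ hs → h ≤h[ la ] h′ → Sorted⇒ (h′ ∷ hs) → Sorted⇒ (h ∷ h′ ∷ hs)
  sorted-cons h h′ hs (u , v , u∈ , _ , hook , hook′ , u≤v) (st , valid , inj₂ (v′ , hook″ , X , _)) =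
    let (ins , st′ , X′) = insert-hook st u∈ (ready-extract st u∈ X (subst (u ≤rl_) (hook-cell-unique hook′ hook″) u≤v)) hook
    in st′ , (ins , valid) , inj₂ (u , hook , X′)

  sorted-state : ∀ hs → SortedHooks la hs → Sorted⇒ hs
  sorted-state [] _ = zero-state , tt , inj₁ refl
  sorted-state (h ∷ []) (rim All.∷ _ , _) =
    let (u , u∈ , hook) = rimhook-cell rim
        (ins , st , X)  = insert-hook zero-state u∈ (ready-zero u∈ zero-state) hook
    in st , (ins , tt) , inj₂ (u , hook , X)
  sorted-state (h ∷ h′ ∷ hs) (_ All.∷ rims , h≤h′ Linked.∷ link) =
    sorted-cons h h′ hs h≤h′ (sorted-state (h′ ∷ hs) (rims , link))

  adds-cancel : ∀ {i j i′ j′} {R : Route i j} {R′ : Route i′ j′} {π ρ π′ ρ′} → Adds R π π′ → Adds R′ ρ ρ′ →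
    (∀ {v} → Route.On R v → Route.On R′ v) → (∀ {v} → Route.On R′ v → Route.On R v) →
    (∀ v → π′ v ≡ ρ′ v) → ∀ v → π v ≡ ρ v
  adds-cancel {R = R} A B to from eq v with Route.On? R v
  ... | yes o = suc-injective (trans (sym (Adds.on A o)) (trans (eq v) (Adds.on B (to o))))
  ... | no ¬o = trans (sym (Adds.out A ¬o)) (trans (eq v) (Adds.out B (¬o ∘ from)))

  last-unique : ∀ h hs h′ hs′ → Last (h ∷ hs) → Last (h′ ∷ hs′) → (∀ v → insertAll la (h ∷ hs) v ≡ insertAll la (h′ ∷ hs′) v) →
    h ≡ h′ × (∀ v → insertAll la hs v ≡ insertAll la hs′ v)
  last-unique h hs h′ hs′ (u , hook , X , A) (u′ , hook′ , Y , B) eq with extract-unique X Y eq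
  ... | refl , to = hook-unique hook hook′ , adds-cancel A B to (proj₂ (extract-unique Y X (λ v → sym (eq v)))) eq

  last-nonzero : ∀ h hs → Last (h ∷ hs) → ¬ (∀ v → 0 ≡ insertAll la (h ∷ hs) v)
  last-nonzero h hs (u , _ , X , _) eq = n≮0 (<-≤-trans (Extract.start X) (≤-reflexive (sym (eq _))))

  -- The filling determines its extraction, so the outermost hooks and their routes agree and can be
  -- cancelled.
  insertAll-injective : ∀ hs hs′ → SortedHooks la hs → SortedHooks la hs′ →
    (∀ v → insertAll la hs v ≡ insertAll la hs′ v) → hs ≡ hs′
  insertAll-injective hs hs′ S S′ eq with sorted-state hs S | sorted-state hs′ S′
  insertAll-injective []       []         S S′ eq | _ | _ = refl
  insertAll-injective []       (h′ ∷ hs′) S S′ eq | _ | _ , _ , inj₂ l = ⊥-elim (last-nonzero h′ hs′ l eq)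
  insertAll-injective (h ∷ hs) []         S S′ eq | _ , _ , inj₂ l | _ = ⊥-elim (last-nonzero h hs l (λ v → sym (eq v)))
  insertAll-injective (h ∷ hs) (h′ ∷ hs′) (_ All.∷ rs , ls) (_ All.∷ rs′ , ls′) eq | _ , _ , inj₂ l | _ , _ , inj₂ l′
    with last-unique h hs h′ hs′ l l′ eq
  ... | refl , eq′ = cong (h ∷_) (insertAll-injective hs hs′ (rs , Linked.tail ls) (rs′ , Linked.tail ls′) eq′)

  module _ {π : RPP} (st : State π) {i j : ℕ} (X : Extract π i j) where
    open Extract X
    open Route route

    remove : RPP
    remove v = if does (On? v) then pred (π v) else π v

    private
      positive : ∀ {v} → Removable π v → π v ≡ suc (pred (π v))
      positive {v} r with π v
      ... | suc _ = refl

    remove-adds : Adds route remove π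
    remove-adds = record
      { on  = λ { {v} o@(f , f≤ , refl) → trans (positive (extract-removable st X f≤))
          (cong (λ b → suc (if b then pred (π v) else π v)) (sym (dec-true (On? v) o))) }
      ; out = λ {v} ¬o → cong (λ b → if b then pred (π v) else π v) (sym (dec-false (On? v) ¬o))
      }

  weight : RPP → List Cell → ℕ
  weight π us = sum (map π us)

  weight-mono : ∀ {π ρ} → (∀ v → π v ≤ ρ v) → ∀ us → weight π us ≤ weight ρ us
  weight-mono le []       = z≤n
  weight-mono le (u ∷ us) = +-mono-≤ (le u) (weight-mono le us)

  weight-strict : ∀ {π ρ u} → (∀ v → π v ≤ ρ v) → π u < ρ u → ∀ {us} → u ∈ us → weight π us < weight ρ us
  weight-strict le lt {_ ∷ us} (here refl) = +-mono-<-≤ lt (weight-mono le us)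
  weight-strict le lt {w ∷ us} (there m)   = +-mono-≤-< (le w) (weight-strict le lt m)

  Factored : RPP → Set
  Factored π = ∃[ hs ] (SortedHooks la hs × (∀ v → π v ≡ insertAll la hs v))

  module _ {π : RPP} (st : State π) {i j : ℕ} (X : Extract π i j) where
    private
      R = Extract.route X

      link : ∀ h hs → IsHookOf la (i , j) h → SortedHooks la hs → Adds R (insertAll la hs) π → Sorted⇒ hs →
        SortedHooks la (h ∷ hs)
      link h []        hook (rims , links) A _ = proj₁ hook All.∷ rims , Linked.[-]
      link h (h′ ∷ hs) hook (rims , links) A (_ , _ , inj₂ (u′ , hook′ , Y , _)) = proj₁ hook All.∷ rims ,
        ((i , j) , u′ , route-∈ R , route-∈ (Extract.route Y) , hook , hook′ , extract-order X A Y) Linked.∷ links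

    -- The removed route obeys the forward rule in what remains, so inserting its hook there adds
    -- exactly the cells that were removed.
    factor-cons : Factored (remove st X) → Factored π
    factor-cons (hs , S , eq) = h ∷ hs , link h hs hook S A (sorted-state hs S) , eq′
      where
      σ = insertAll la hs
      A : Adds R σ π
      A = record
        { on  = λ {v} o → trans (Adds.on (remove-adds st X) o) (cong suc (eq v))
        ; out = λ {v} ¬o → trans (Adds.out (remove-adds st X) ¬o) (eq v) }
      h = proj₁ (hook-exists (route-∈ R))
      hook : IsHookOf la (i , j) h
      hook = proj₂ (hook-exists (route-∈ R))
      B : Adds R σ (h *[ la ] σ)
      B = insert-adds (proj₁ (sorted-state hs S)) R (Removal.moves st X A) hook
      eq′ : ∀ v → π v ≡ (h *[ la ] σ) v
      eq′ v = case Route.On? R v of λ where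
        (yes o) → trans (Adds.on A o) (sym (Adds.on B o))
        (no ¬o) → trans (Adds.out A ¬o) (sym (Adds.out B ¬o))

  -- Each removal lowers the sum of the entries over the shape, and n bounds this sum.
  factor : ∀ n π → State π → weight π (cells la) < n → Factored π
  factor (suc n) π st w< with zero-or-extract st
  ... | inj₁ z = [] , (All.[] , Linked.[]) , z
  ... | inj₂ (i , j , X) = factor-cons st X
      (factor n (remove st X) (Removal.state st X (remove-adds st X)) (≤-trans lighter (≤-pred w<)))
    where
    A = remove-adds st X
    lighter : weight (remove st X) (cells la) < weight π (cells la)
    lighter = weight-strict (Adds.grows A) (≤-reflexive (sym (Adds.on A (0 , z≤n , refl)))) (∈-cells⁺ (Route.mem (Extract.route X) z≤n))

  -- The given filling is arbitrary outside the shape, whereas `State` prescribes 0 there.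
  normalise : RPP → RPP
  normalise π u = if does (u ∈λ? la) then π u else 0

  normalise-∈ : ∀ π {u} → u ∈λ la → normalise π u ≡ π u
  normalise-∈ π {u} u∈ = cong (λ b → if b then π u else 0) (dec-true (u ∈λ? la) u∈)

  normalise-∉ : ∀ π {u} → ¬ (u ∈λ la) → normalise π u ≡ 0
  normalise-∉ π {u} u∉ = cong (λ b → if b then π u else 0) (dec-false (u ∈λ? la) u∉)

  normalise-state : ∀ {π} → IsRPP la π → State (normalise π)
  normalise-state {π} rpp = record
    { off = normalise-∉ π ; east = λ {x} {y} e∈ → mono {x , y} e∈ (λ u∈ → proj₁ (rpp (x , y) u∈) e∈)
    ; south = λ {x} {y} s∈ → mono {x , y} s∈ (λ u∈ → proj₂ (rpp (x , y) u∈) s∈) }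
    where
    mono : ∀ {u v} → v ∈λ la → (u ∈λ la → π u ≤ π v) → normalise π u ≤ normalise π v
    mono {u} v∈ le = case u ∈λ? la of λ where
      (no u∉)  → ≤-trans (≤-reflexive (normalise-∉ π u∉)) z≤n
      (yes u∈) → ≤-trans (≤-reflexive (normalise-∈ π u∈)) (≤-trans (le u∈) (≤-reflexive (sym (normalise-∈ π v∈))))

  ≐⇒≗ : ∀ {π ρ} → State π → State ρ → π ≐[ la ] ρ → ∀ v → π v ≡ ρ v
  ≐⇒≗ stπ stρ eq v with v ∈λ? la
  ... | yes v∈ = eq v v∈
  ... | no v∉  = trans (State.off stπ v∉) (sym (State.off stρ v∉))

mainTheorem1 : (la : List ℕ) → IsPartition la →
    ((π : RPP) → IsRPP la π →
    ∃[ hs ] ((SortedHooks la hs × ValidChain la hs × π ≐[ la ] insertAll la hs)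
    × ((hs' : List Path) →
    SortedHooks la hs' × ValidChain la hs' × π ≐[ la ] insertAll la hs' →
    hs' ≡ hs)))
    × ((hs : List Path) → SortedHooks la hs →
    ValidChain la hs × IsRPP la (insertAll la hs))
mainTheorem1 la part = bijection , λ hs S → let (st , valid , _) = sorted-state hs S in valid , state⇒RPP st
  where
  open Shape la part
  bijection : (π : RPP) → IsRPP la π →
    ∃[ hs ] ((SortedHooks la hs × ValidChain la hs × π ≐[ la ] insertAll la hs)
    × ((hs' : List Path) → SortedHooks la hs' × ValidChain la hs' × π ≐[ la ] insertAll la hs' → hs' ≡ hs))
  bijection π rpp with factor (suc (weight (normalise π) (cells la))) (normalise π) (normalise-state rpp) ≤-refl
  ... | hs , S , eq = hs , (S , proj₁ (proj₂ (sorted-state hs S)) , π≐) , unique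
    where
    π≐ : π ≐[ la ] insertAll la hs
    π≐ u u∈ = trans (sym (normalise-∈ π u∈)) (eq u)
    unique : (hs' : List Path) → SortedHooks la hs' × ValidChain la hs' × π ≐[ la ] insertAll la hs' → hs' ≡ hs
    -- Both insertion results vanish outside the shape, so agreement on it is agreement everywhere.
    unique hs' (S' , _ , π≐') = insertAll-injective hs' hs S' S
      (≐⇒≗ (proj₁ (sorted-state hs' S')) (proj₁ (sorted-state hs S)) (λ u u∈ → trans (sym (π≐' u u∈)) (π≐ u u∈)))
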